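{- Let $p$ be a prime and $(G,\theta)$ a $p$-oriented profinite group. Then $(G,\theta)$ satisfies formal Hilbert 90 if and only if it admits a Hilbert 90 module.
   Context: A $p$-oriented profinite group is a pair $(G,\theta)$ with $G$ a profinite group and $\theta\colon G\to\mathbb Z_p^\times$ a continuous homomorphism. For $n\geq 1$, $\mathbb Z/p^n\mathbb Z(1)$ denotes the discrete $G$-module $\mathbb Z/p^n\mathbb Z$ with $g\cdot v=\theta(g)v$. $(G,\theta)$ satisfies formal Hilbert 90 if for every open subgroup $H\subset G$ and every $n\geq1$ the reduction map $H^1(H,\mathbb Z/p^n\mathbb Z(1))\to H^1(H,\mathbb Z/p\mathbb Z(1))$ is surjective. Let $S$ be the discrete $G$-module with underlying group $\mathbb Q/\mathbb Z_{(p)}$ on which $g\in G$ acts by multiplication by $\theta(g)$. A Hilbert 90 module for $(G,\theta)$ is a discrete $G$-module $M$ such that (i) $pM=M$, (ii) the $p$-primary torsion subgroup $M\{p\}$ is isomorphic to $S$ as a $G$-module, and (iii) $H^1(H,M)=0$ for every open subgroup $H\subset G$. -}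

module Defs where

open import Algebra.Bundles using (Group; AbelianGroup; CommutativeRing)
open import Algebra.Morphism.Structures using (IsGroupHomomorphism; IsGroupIsomorphism)
import Algebra.Properties.AbelianGroup as AbelianGroupProperties
import Algebra.Properties.CommutativeSemigroup as CommutativeSemigroupProperties
import Algebra.Properties.CommutativeMonoid.Mult as Mult
open import Data.Integer as ℤ using (ℤ; +_; 0ℤ; 1ℤ)
import Data.Integer.Properties as ℤP
open import Data.Integer.Divisibility.Signed as ℤ∣ using (divides) renaming (_∣_ to _∣ℤ_)
open import Data.Integer.GCD using (gcd)
open import Data.Integer.Solver using (module +-*-Solver)
open import Data.List.Base using (List)
open import Data.List.Relation.Unary.Any using (Any)
open import Data.Nat as ℕ using (ℕ; zero; suc)
import Data.Nat.Properties as ℕP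
open import Data.Nat.Divisibility as ℕ∣ using (_∣_; _∤_)
open import Data.Nat.Induction using (<-wellFounded)
open import Data.Nat.Primality using (Prime; euclidsLemma; prime⇒nonZero; prime⇒nonTrivial)
open import Data.Product using (Σ; ∃-syntax; _×_; _,_; proj₁; proj₂)
open import Data.Rational as ℚ using (ℚ; 0ℚ; ↥_; ↧_; ↧ₙ_; toℚᵘ)
import Data.Rational.Properties as ℚP
import Data.Rational.Solver as ℚSolver
open import Data.Rational.Unnormalised as ℚᵘ using (mkℚᵘ; *≡*)
import Data.Rational.Unnormalised.Properties as ℚᵘP
open import Data.Sum.Base using (_⊎_; inj₁; inj₂; [_,_]′)
open import Data.Unit.Polymorphic using (⊤)
open import Function.Base using (_∘_; id)
open import Function.Bundles using (_⇔_; mk⇔; Equivalence)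
open import Function.Definitions using (Surjective)
open import Induction.WellFounded using (Acc; acc)
open import Level using (Level; _⊔_; 0ℓ) renaming (suc to lsuc)
open import Relation.Binary.Bundles using (Setoid)
open import Relation.Binary.Definitions using (_Respects_)
open import Relation.Binary.PropositionalEquality as ≡ using (_≡_; refl; cong; subst; module ≡-Reasoning)
import Relation.Binary.Reasoning.Setoid as SetoidReasoning
open import Relation.Nullary using (¬_; yes; no; contradiction)
open import Relation.Unary using (Pred)

private
  variable
    ℓ m n : Level

-- Subsets of a setoid are predicates at its own level; Open only holds
-- of predicates that respect the setoid equality.
record Topology (A : Setoid ℓ ℓ) : Set (lsuc (lsuc ℓ)) where
  open Setoid A
  field
    Open        : Pred Carrier ℓ → Set (lsuc ℓ)
    open-resp-≈ : ∀ {U} → Open U → U Respects _≈_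
    open-ext    : ∀ {U V} → (∀ x → U x ⇔ V x) → Open U → Open V
    open-univ   : Open (λ _ → ⊤)
    open-∩      : ∀ {U V} → Open U → Open V → Open (λ x → U x × V x)
    open-⋃      : ∀ {I : Set ℓ} (U : I → Pred Carrier ℓ) → (∀ i → Open (U i)) →
                  Open (λ x → ∃[ i ] U i x)

  Compact : Set (lsuc ℓ)
  Compact = ∀ {I : Set ℓ} (U : I → Pred Carrier ℓ) → (∀ i → Open (U i)) →
            (∀ x → ∃[ i ] U i x) →
            Σ (List I) λ is → ∀ x → Any (λ i → U i x) is

  Hausdorff : Set (lsuc ℓ)
  Hausdorff = ∀ {x y} → ¬ (x ≈ y) →
              ∃[ U ] ∃[ V ] Open U × Open V × U x × V y × (∀ z → ¬ (U z × V z))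

  Connected : Pred Carrier ℓ → Set (lsuc ℓ)
  Connected C = ∀ {U V} → Open U → Open V → (∀ x → C x → U x ⊎ V x) →
                (∃[ x ] C x × U x) → (∃[ x ] C x × V x) → ∃[ x ] C x × U x × V x

  TotallyDisconnected : Set (lsuc ℓ)
  TotallyDisconnected = ∀ {C} → Connected C → ∀ {x y} → C x → C y → x ≈ y

-- Continuity of a map into a discrete space.
LocallyConstant : {A : Setoid ℓ ℓ} → Topology A → (B : Setoid m m) →
                  (Setoid.Carrier A → Setoid.Carrier B) → Set (lsuc ℓ ⊔ m)
LocallyConstant τ B f =
  ∀ x → ∃[ U ] Open U × U x × (∀ y → U y → f y ≈ f x)
  where
  open Topology τ
  open Setoid B

record TopologicalGroup ℓ : Set (lsuc (lsuc ℓ)) where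
  field
    group    : Group ℓ ℓ
  open Group group public
  field
    topology : Topology setoid
  open Topology topology public
  field
    ∙-continuous  : ∀ {W} → Open W → ∀ {g h} → W (g ∙ h) →
                    ∃[ U ] ∃[ V ] Open U × Open V × U g × V h ×
                                  (∀ x y → U x → V y → W (x ∙ y))
    ⁻¹-continuous : ∀ {U} → Open U → Open (λ g → U (g ⁻¹))

record ProfiniteGroup ℓ : Set (lsuc (lsuc ℓ)) where
  field
    topologicalGroup    : TopologicalGroup ℓ
  open TopologicalGroup topologicalGroup public
  field
    compact             : Compact
    hausdorff           : Hausdorff
    totallyDisconnected : TotallyDisconnected

record OpenSubgroup (G : TopologicalGroup ℓ) : Set (lsuc ℓ) where
  open TopologicalGroup G
  field
    member    : Pred Carrier ℓ
    isOpen    : Open member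
    ε-closed  : member ε
    ∙-closed  : ∀ {g h} → member g → member h → member (g ∙ h)
    ⁻¹-closed : ∀ {g} → member g → member (g ⁻¹)

module _ {G : TopologicalGroup ℓ} (H : OpenSubgroup G) where
  private module G = TopologicalGroup G
  open OpenSubgroup H

  asTopologicalGroup : TopologicalGroup ℓ
  asTopologicalGroup = record
    { group = record
      { Carrier = Σ G.Carrier member
      ; _≈_     = λ x y → proj₁ x G.≈ proj₁ y
      ; _∙_     = λ x y → proj₁ x G.∙ proj₁ y , ∙-closed (proj₂ x) (proj₂ y)
      ; ε       = G.ε , ε-closed
      ; _⁻¹     = λ x → proj₁ x G.⁻¹ , ⁻¹-closed (proj₂ x)
      ; isGroup = record
        { isMonoid = record
          { isSemigroup = record
            { isMagma = record
              { isEquivalence = record { refl = G.refl ; sym = G.sym ; trans = G.trans }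
              ; ∙-cong        = G.∙-cong
              }
            ; assoc = λ x y z → G.assoc (proj₁ x) (proj₁ y) (proj₁ z)
            }
          ; identity = (λ x → G.identityˡ (proj₁ x)) , (λ x → G.identityʳ (proj₁ x))
          }
        ; inverse = (λ x → G.inverseˡ (proj₁ x)) , (λ x → G.inverseʳ (proj₁ x))
        ; ⁻¹-cong = G.⁻¹-cong
        }
      }
    ; topology = record
      { Open        = λ W → ∃[ U ] G.Open U × (∀ x → W x ⇔ U (proj₁ x))
      ; open-resp-≈ = λ (U , oU , W⇔U) {x} {y} x≈y Wx →
          from (W⇔U y) (G.open-resp-≈ oU x≈y (to (W⇔U x) Wx))
      ; open-ext    = λ W⇔W′ (U , oU , W⇔U) → U , oU , λ x →
          mk⇔ (to (W⇔U x) ∘ from (W⇔W′ x)) (to (W⇔W′ x) ∘ from (W⇔U x))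
      ; open-univ   = (λ _ → ⊤) , G.open-univ , λ _ → mk⇔ id id
      ; open-∩      = λ (U , oU , e) (U′ , oU′ , e′) →
          (λ x → U x × U′ x) , G.open-∩ oU oU′ , λ x →
          mk⇔ (λ (a , b) → to (e x) a , to (e′ x) b)
              (λ (a , b) → from (e x) a , from (e′ x) b)
      ; open-⋃      = λ W oW →
          (λ x → ∃[ i ] proj₁ (oW i) x) ,
          G.open-⋃ (λ i → proj₁ (oW i)) (λ i → proj₁ (proj₂ (oW i))) , λ x →
          mk⇔ (λ (i , w) → i , to (proj₂ (proj₂ (oW i)) x) w)
              (λ (i , u) → i , from (proj₂ (proj₂ (oW i)) x) u)
      }
    ; ∙-continuous  = λ (U , oU , e) {g} {h} w →
        let A , B , oA , oB , a , b , AB⊆U = G.∙-continuous oU (to (e _) w)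
        in A ∘ proj₁ , B ∘ proj₁ ,
           (A , oA , λ _ → mk⇔ id id) , (B , oB , λ _ → mk⇔ id id) , a , b ,
           λ x y Ax By → from (e _) (AB⊆U (proj₁ x) (proj₁ y) Ax By)
    ; ⁻¹-continuous = λ (U , oU , e) →
        (λ g → U (g G.⁻¹)) , G.⁻¹-continuous oU , λ x → mk⇔ (to (e _)) (from (e _))
    }
    where open Equivalence

record DiscreteModule (G : TopologicalGroup ℓ) m : Set (lsuc ℓ ⊔ lsuc m) where
  private module G = TopologicalGroup G
  field
    abelianGroup : AbelianGroup m m
  open AbelianGroup abelianGroup public
    renaming ( _∙_ to infixl 6 _+_; ε to 0#; _⁻¹ to infix 8 -_; ∙-cong to +-cong
             ; ∙-congˡ to +-congˡ; ∙-congʳ to +-congʳ; ⁻¹-cong to -‿cong; assoc to +-assoc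
             ; comm to +-comm; identityˡ to +-identityˡ; identityʳ to +-identityʳ
             ; inverseˡ to -‿inverseˡ; inverseʳ to -‿inverseʳ )
  infixr 7 _·_
  field
    _·_          : G.Carrier → Carrier → Carrier
    ·-cong       : ∀ {g h x y} → g G.≈ h → x ≈ y → g · x ≈ h · y
    ·-identity   : ∀ x → G.ε · x ≈ x
    ·-assoc      : ∀ g h x → (g G.∙ h) · x ≈ g · (h · x)
    ·-distrib-+  : ∀ g x y → g · (x + y) ≈ g · x + g · y
    ·-continuous : ∀ x → LocallyConstant G.topology setoid (λ g → g · x)

  open SetoidReasoning setoid
  open AbelianGroupProperties abelianGroup using (inverseʳ-unique; identityʳ-unique)

  ·-zero : ∀ g → g · 0# ≈ 0#
  ·-zero g = identityʳ-unique (g · 0#) (g · 0#) (begin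
    g · 0# + g · 0#  ≈⟨ ·-distrib-+ g 0# 0# ⟨
    g · (0# + 0#)    ≈⟨ ·-cong G.refl (+-identityˡ 0#) ⟩
    g · 0#           ∎)

  ·-neg : ∀ g x → g · (- x) ≈ - (g · x)
  ·-neg g x = inverseʳ-unique (g · x) (g · (- x)) (begin
    g · x + g · (- x)  ≈⟨ ·-distrib-+ g x (- x) ⟨
    g · (x + - x)      ≈⟨ ·-cong G.refl (-‿inverseʳ x) ⟩
    g · 0#             ≈⟨ ·-zero g ⟩
    0#                 ∎)

module _ {G : TopologicalGroup ℓ} where
  private module G = TopologicalGroup G

  record ModuleHom (M : DiscreteModule G m) (N : DiscreteModule G n) : Set (ℓ ⊔ m ⊔ n) where
    private
      module M = DiscreteModule M
      module N = DiscreteModule N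
    field
      ⟦_⟧                 : M.Carrier → N.Carrier
      isGroupHomomorphism : IsGroupHomomorphism M.rawGroup N.rawGroup ⟦_⟧
      equivariant         : ∀ g x → ⟦ g M.· x ⟧ N.≈ g N.· ⟦ x ⟧
    open IsGroupHomomorphism isGroupHomomorphism public

  record ModuleIso (M : DiscreteModule G m) (N : DiscreteModule G n) : Set (ℓ ⊔ m ⊔ n) where
    private
      module M = DiscreteModule M
      module N = DiscreteModule N
    field
      ⟦_⟧                : M.Carrier → N.Carrier
      isGroupIsomorphism : IsGroupIsomorphism M.rawGroup N.rawGroup ⟦_⟧
      equivariant        : ∀ g x → ⟦ g M.· x ⟧ N.≈ g N.· ⟦ x ⟧

restrict : {G : TopologicalGroup ℓ} (H : OpenSubgroup G) →
           DiscreteModule G m → DiscreteModule (asTopologicalGroup H) m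
restrict H M = record
  { abelianGroup = abelianGroup
  ; _·_          = λ h → proj₁ h ·_
  ; ·-cong       = ·-cong
  ; ·-identity   = ·-identity
  ; ·-assoc      = λ g h → ·-assoc (proj₁ g) (proj₁ h)
  ; ·-distrib-+  = λ g → ·-distrib-+ (proj₁ g)
  ; ·-continuous = λ x h →
      let U , oU , Uh , const = ·-continuous x (proj₁ h)
      in U ∘ proj₁ , (U , oU , λ _ → mk⇔ id id) , Uh , λ y → const (proj₁ y)
  }
  where open DiscreteModule M

restrictHom : {G : TopologicalGroup ℓ} (H : OpenSubgroup G)
              {M : DiscreteModule G m} {N : DiscreteModule G n} →
              ModuleHom M N → ModuleHom (restrict H M) (restrict H N)
restrictHom H φ = record
  { ⟦_⟧                 = ⟦_⟧
  ; isGroupHomomorphism = isGroupHomomorphism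
  ; equivariant         = λ h → equivariant (proj₁ h)
  }
  where open ModuleHom φ

module _ {G : TopologicalGroup ℓ} (p : ℕ) (M : DiscreteModule G m) where
  open DiscreteModule M
  open Mult commutativeMonoid using (×-congʳ; ×-congˡ; ×-assocˡ; ×-distrib-+)
    renaming (_×_ to infixl 7 _×ₘ_)
  open SetoidReasoning setoid
  open AbelianGroupProperties abelianGroup using (inverseʳ-unique; ε⁻¹≈ε)
  private module G = TopologicalGroup G

  IsPrimaryTorsion : Pred Carrier m
  IsPrimaryTorsion x = ∃[ n ] (p ℕ.^ n) ×ₘ x ≈ 0#

  ×-zero : ∀ n → n ×ₘ 0# ≈ 0#
  ×-zero zero    = Setoid.refl setoid
  ×-zero (suc n) = trans (+-identityˡ _) (×-zero n)

  ×-neg : ∀ n x → n ×ₘ (- x) ≈ - (n ×ₘ x)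
  ×-neg n x = inverseʳ-unique _ _ (begin
    n ×ₘ x + n ×ₘ (- x)  ≈⟨ ×-distrib-+ x (- x) n ⟨
    n ×ₘ (x + - x)       ≈⟨ ×-congʳ n (-‿inverseʳ x) ⟩
    n ×ₘ 0#              ≈⟨ ×-zero n ⟩
    0#                   ∎)

  ×-· : ∀ n g x → n ×ₘ (g · x) ≈ g · (n ×ₘ x)
  ×-· zero    g x = sym (·-zero g)
  ×-· (suc n) g x = trans (+-congˡ (×-· n g x)) (sym (·-distrib-+ g x (n ×ₘ x)))

  kill : ∀ a b x → a ×ₘ x ≈ 0# → (b ℕ.* a) ×ₘ x ≈ 0#
  kill a b x ax≈0 = begin
    (b ℕ.* a) ×ₘ x   ≈⟨ ×-assocˡ x b a ⟨
    b ×ₘ (a ×ₘ x)    ≈⟨ ×-congʳ b ax≈0 ⟩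
    b ×ₘ 0#          ≈⟨ ×-zero b ⟩
    0#               ∎

  torsion-+ : ∀ {x y} → IsPrimaryTorsion x → IsPrimaryTorsion y → IsPrimaryTorsion (x + y)
  torsion-+ {x} {y} (a , ax) (b , by) = a ℕ.+ b , (begin
    (p ℕ.^ (a ℕ.+ b)) ×ₘ (x + y)
      ≈⟨ ×-distrib-+ x y (p ℕ.^ (a ℕ.+ b)) ⟩
    (p ℕ.^ (a ℕ.+ b)) ×ₘ x + (p ℕ.^ (a ℕ.+ b)) ×ₘ y
      ≈⟨ +-cong (×-congˡ (≡.trans (ℕP.^-distribˡ-+-* p a b) (ℕP.*-comm (p ℕ.^ a) (p ℕ.^ b))))
                (×-congˡ (ℕP.^-distribˡ-+-* p a b)) ⟩
    (p ℕ.^ b ℕ.* p ℕ.^ a) ×ₘ x + (p ℕ.^ a ℕ.* p ℕ.^ b) ×ₘ y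
      ≈⟨ +-cong (kill (p ℕ.^ a) (p ℕ.^ b) x ax) (kill (p ℕ.^ b) (p ℕ.^ a) y by) ⟩
    0# + 0#
      ≈⟨ +-identityˡ 0# ⟩
    0# ∎)

  primaryTorsion : DiscreteModule G m
  primaryTorsion = record
    { abelianGroup = record
      { Carrier = Σ Carrier IsPrimaryTorsion
      ; _≈_     = λ x y → proj₁ x ≈ proj₁ y
      ; _∙_     = λ x y → proj₁ x + proj₁ y , torsion-+ (proj₂ x) (proj₂ y)
      ; ε       = 0# , 0 , ×-zero 1
      ; _⁻¹     = λ (x , n , px) →
                    - x , n , trans (×-neg (p ℕ.^ n) x) (trans (-‿cong px) ε⁻¹≈ε)
      ; isAbelianGroup = record
        { isGroup = record
          { isMonoid = record
            { isSemigroup = record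
              { isMagma = record
                { isEquivalence = record { refl = Setoid.refl setoid ; sym = sym ; trans = trans }
                ; ∙-cong        = +-cong
                }
              ; assoc = λ x y z → +-assoc (proj₁ x) (proj₁ y) (proj₁ z)
              }
            ; identity = (λ x → +-identityˡ (proj₁ x)) , (λ x → +-identityʳ (proj₁ x))
            }
          ; inverse = (λ x → -‿inverseˡ (proj₁ x)) , (λ x → -‿inverseʳ (proj₁ x))
          ; ⁻¹-cong = -‿cong
          }
        ; comm = λ x y → +-comm (proj₁ x) (proj₁ y)
        }
      }
    ; _·_          = λ g (x , n , px) →
        g · x , n , trans (×-· (p ℕ.^ n) g x) (trans (·-cong G.refl px) (·-zero g))
    ; ·-cong       = ·-cong
    ; ·-identity   = λ x → ·-identity (proj₁ x)
    ; ·-assoc      = λ g h x → ·-assoc g h (proj₁ x)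
    ; ·-distrib-+  = λ g x y → ·-distrib-+ g (proj₁ x) (proj₁ y)
    ; ·-continuous = λ x → ·-continuous (proj₁ x)
    }

module _ {G : TopologicalGroup ℓ} (M : DiscreteModule G m) where
  private module G = TopologicalGroup G
  open DiscreteModule M

  record Cocycle : Set (lsuc ℓ ⊔ m) where
    field
      ⟦_⟧        : G.Carrier → Carrier
      ⟦⟧-cong    : ∀ {g h} → g G.≈ h → ⟦ g ⟧ ≈ ⟦ h ⟧
      continuous : LocallyConstant G.topology setoid ⟦_⟧
      cocycle    : ∀ g h → ⟦ g G.∙ h ⟧ ≈ ⟦ g ⟧ + g · ⟦ h ⟧

  open Cocycle

  -- The two cocycles differ by the coboundary of some x.
  infix 4 _~_
  _~_ : Cocycle → Cocycle → Set (ℓ ⊔ m)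
  f ~ f′ = ∃[ x ] (∀ g → ⟦ f ⟧ g ≈ ⟦ f′ ⟧ g + (g · x - x))

  open SetoidReasoning setoid
  open AbelianGroupProperties abelianGroup using (⁻¹-∙-comm; ε⁻¹≈ε)
  open CommutativeSemigroupProperties commutativeSemigroup using (interchange)

  infixl 6 _⊕_
  _⊕_ : Cocycle → Cocycle → Cocycle
  f ⊕ f′ = record
    { ⟦_⟧        = λ g → ⟦ f ⟧ g + ⟦ f′ ⟧ g
    ; ⟦⟧-cong    = λ e → +-cong (⟦⟧-cong f e) (⟦⟧-cong f′ e)
    ; continuous = λ g →
        let U , oU , Ug , c = continuous f g
            V , oV , Vg , d = continuous f′ g
        in (λ x → U x × V x) , G.open-∩ oU oV , (Ug , Vg) ,
           λ y (Uy , Vy) → +-cong (c y Uy) (d y Vy)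
    ; cocycle    = λ g h → begin
        ⟦ f ⟧ (g G.∙ h) + ⟦ f′ ⟧ (g G.∙ h)
          ≈⟨ +-cong (cocycle f g h) (cocycle f′ g h) ⟩
        (⟦ f ⟧ g + g · ⟦ f ⟧ h) + (⟦ f′ ⟧ g + g · ⟦ f′ ⟧ h)
          ≈⟨ interchange _ _ _ _ ⟩
        (⟦ f ⟧ g + ⟦ f′ ⟧ g) + (g · ⟦ f ⟧ h + g · ⟦ f′ ⟧ h)
          ≈⟨ +-congˡ (·-distrib-+ g _ _) ⟨
        (⟦ f ⟧ g + ⟦ f′ ⟧ g) + g · (⟦ f ⟧ h + ⟦ f′ ⟧ h) ∎
    }

  𝟎 : Cocycle
  𝟎 = record
    { ⟦_⟧        = λ _ → 0#
    ; ⟦⟧-cong    = λ _ → Setoid.refl setoid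
    ; continuous = λ _ → (λ _ → ⊤) , G.open-univ , _ , λ _ _ → Setoid.refl setoid
    ; cocycle    = λ g _ → sym (trans (+-identityˡ _) (·-zero g))
    }

  ⊖_ : Cocycle → Cocycle
  ⊖ f = record
    { ⟦_⟧        = λ g → - ⟦ f ⟧ g
    ; ⟦⟧-cong    = λ e → -‿cong (⟦⟧-cong f e)
    ; continuous = λ g →
        let U , oU , Ug , c = continuous f g in U , oU , Ug , λ y Uy → -‿cong (c y Uy)
    ; cocycle    = λ g h → begin
        - ⟦ f ⟧ (g G.∙ h)               ≈⟨ -‿cong (cocycle f g h) ⟩
        - (⟦ f ⟧ g + g · ⟦ f ⟧ h)       ≈⟨ ⁻¹-∙-comm _ _ ⟨
        - ⟦ f ⟧ g + - (g · ⟦ f ⟧ h)     ≈⟨ +-congˡ (·-neg g _) ⟨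
        - ⟦ f ⟧ g + g · (- ⟦ f ⟧ h)     ∎
    }

  ∂ : Carrier → G.Carrier → Carrier
  ∂ x g = g · x - x

  ∂-0 : ∀ g → ∂ 0# g ≈ 0#
  ∂-0 g = trans (+-cong (·-zero g) ε⁻¹≈ε) (+-identityˡ 0#)

  ∂-+ : ∀ x y g → ∂ (x + y) g ≈ ∂ x g + ∂ y g
  ∂-+ x y g = begin
    g · (x + y) + - (x + y)          ≈⟨ +-cong (·-distrib-+ g x y) (sym (⁻¹-∙-comm x y)) ⟩
    (g · x + g · y) + (- x + - y)    ≈⟨ interchange _ _ _ _ ⟩
    ∂ x g + ∂ y g                    ∎

  ∂-neg : ∀ x g → ∂ (- x) g ≈ - ∂ x g
  ∂-neg x g = begin
    g · (- x) + - (- x)   ≈⟨ +-congʳ (·-neg g x) ⟩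
    - (g · x) + - (- x)   ≈⟨ ⁻¹-∙-comm _ _ ⟩
    - ∂ x g               ∎

  pointwise : ∀ {f f′} → (∀ g → ⟦ f ⟧ g ≈ ⟦ f′ ⟧ g) → f ~ f′
  pointwise e = 0# , λ g → trans (e g) (sym (trans (+-congˡ (∂-0 g)) (+-identityʳ _)))

  ~-sym : ∀ {f f′} → f ~ f′ → f′ ~ f
  ~-sym {f} {f′} (x , e) = - x , λ g → sym (begin
    ⟦ f ⟧ g + ∂ (- x) g               ≈⟨ +-cong (e g) (∂-neg x g) ⟩
    ⟦ f′ ⟧ g + ∂ x g + - ∂ x g        ≈⟨ +-assoc _ _ _ ⟩
    ⟦ f′ ⟧ g + (∂ x g + - ∂ x g)      ≈⟨ +-congˡ (-‿inverseʳ _) ⟩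
    ⟦ f′ ⟧ g + 0#                     ≈⟨ +-identityʳ _ ⟩
    ⟦ f′ ⟧ g                          ∎)

  ~-trans : ∀ {f f′ f″} → f ~ f′ → f′ ~ f″ → f ~ f″
  ~-trans {f} {f′} {f″} (x , e) (y , e′) = y + x , λ g → begin
    ⟦ f ⟧ g                           ≈⟨ e g ⟩
    ⟦ f′ ⟧ g + ∂ x g                  ≈⟨ +-congʳ (e′ g) ⟩
    ⟦ f″ ⟧ g + ∂ y g + ∂ x g          ≈⟨ +-assoc _ _ _ ⟩
    ⟦ f″ ⟧ g + (∂ y g + ∂ x g)        ≈⟨ +-congˡ (∂-+ y x g) ⟨
    ⟦ f″ ⟧ g + ∂ (y + x) g            ∎

  ⊕-cong : ∀ {f f′ h h′} → f ~ f′ → h ~ h′ → (f ⊕ h) ~ (f′ ⊕ h′)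
  ⊕-cong (x , e) (y , e′) = x + y , λ g →
    trans (+-cong (e g) (e′ g))
      (trans (interchange _ _ _ _) (+-congˡ (sym (∂-+ x y g))))

  ⊖-cong : ∀ {f f′} → f ~ f′ → (⊖ f) ~ (⊖ f′)
  ⊖-cong (x , e) = - x , λ g →
    trans (-‿cong (e g)) (trans (sym (⁻¹-∙-comm _ _)) (+-congˡ (sym (∂-neg x g))))

  H¹ : AbelianGroup (lsuc ℓ ⊔ m) (ℓ ⊔ m)
  H¹ = record
    { Carrier = Cocycle
    ; _≈_     = _~_
    ; _∙_     = _⊕_
    ; ε       = 𝟎
    ; _⁻¹     = ⊖_
    ; isAbelianGroup = record
      { isGroup = record
        { isMonoid = record
          { isSemigroup = record
            { isMagma = record
              { isEquivalence = record
                { refl  = λ {f} → pointwise {f} {f} (λ _ → Setoid.refl setoid)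
                ; sym   = λ {f} {f′} → ~-sym {f} {f′}
                ; trans = λ {f} {f′} {f″} → ~-trans {f} {f′} {f″}
                }
              ; ∙-cong = λ {f} {f′} {h} {h′} → ⊕-cong {f} {f′} {h} {h′}
              }
            ; assoc = λ a b c → pointwise {(a ⊕ b) ⊕ c} {a ⊕ (b ⊕ c)} (λ _ → +-assoc _ _ _)
            }
          ; identity = (λ a → pointwise {𝟎 ⊕ a} {a} (λ _ → +-identityˡ _))
                     , (λ a → pointwise {a ⊕ 𝟎} {a} (λ _ → +-identityʳ _))
          }
        ; inverse = (λ a → pointwise {(⊖ a) ⊕ a} {𝟎} (λ _ → -‿inverseˡ _))
                  , (λ a → pointwise {a ⊕ (⊖ a)} {𝟎} (λ _ → -‿inverseʳ _))
        ; ⁻¹-cong = λ {f} {f′} → ⊖-cong {f} {f′}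
        }
      ; comm = λ a b → pointwise {a ⊕ b} {b ⊕ a} (λ _ → +-comm _ _)
      }
    }

IsTrivial : AbelianGroup m n → Set (m ⊔ n)
IsTrivial A = ∀ x → x ≈ ε
  where open AbelianGroup A

module _ {G : TopologicalGroup ℓ} {M : DiscreteModule G m} {N : DiscreteModule G n} where
  private
    module G = TopologicalGroup G
    module N = DiscreteModule N

  H¹-map : ModuleHom M N → AbelianGroup.Carrier (H¹ M) → AbelianGroup.Carrier (H¹ N)
  H¹-map φ f = record
    { ⟦_⟧        = λ g → φ.⟦ f.⟦ g ⟧ ⟧
    ; ⟦⟧-cong    = λ e → φ.⟦⟧-cong (f.⟦⟧-cong e)
    ; continuous = λ g →
        let U , oU , Ug , c = f.continuous g in U , oU , Ug , λ y Uy → φ.⟦⟧-cong (c y Uy)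
    ; cocycle    = λ g h →
        N.trans (φ.⟦⟧-cong (f.cocycle g h))
          (N.trans (φ.homo _ _) (N.+-congˡ (φ.equivariant g _)))
    }
    where
    module φ = ModuleHom φ
    module f = Cocycle f

infix 4 _≡_[mod_]
_≡_[mod_] : ℤ → ℤ → ℕ → Set
a ≡ b [mod q ] = (+ q) ∣ℤ (a ℤ.- b)

module _ {q : ℕ} where
  open +-*-Solver

  ≡⇒≡mod : ∀ {a b} → a ≡ b → a ≡ b [mod q ]
  ≡⇒≡mod {a} refl = divides 0ℤ (ℤP.+-inverseʳ a)

  mod-refl : ∀ a → a ≡ a [mod q ]
  mod-refl a = ≡⇒≡mod {a} refl

  mod-sym : ∀ {a b} → a ≡ b [mod q ] → b ≡ a [mod q ]
  mod-sym {a} {b} e = subst (+ q ∣ℤ_) (solve 2 (λ a b → :- (a :- b) := b :- a) refl a b) (ℤ∣.∣m⇒∣-m e)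

  mod-trans : ∀ {a b c} → a ≡ b [mod q ] → b ≡ c [mod q ] → a ≡ c [mod q ]
  mod-trans {a} {b} {c} e e′ =
    subst (+ q ∣ℤ_) (solve 3 (λ a b c → (a :- b) :+ (b :- c) := a :- c) refl a b c) (ℤ∣.∣m∣n⇒∣m+n e e′)

  mod-+ : ∀ {a b c d} → a ≡ b [mod q ] → c ≡ d [mod q ] → a ℤ.+ c ≡ b ℤ.+ d [mod q ]
  mod-+ {a} {b} {c} {d} e e′ = subst (+ q ∣ℤ_)
    (solve 4 (λ a b c d → (a :- b) :+ (c :- d) := (a :+ c) :- (b :+ d)) refl a b c d)
    (ℤ∣.∣m∣n⇒∣m+n e e′)

  mod-neg : ∀ {a b} → a ≡ b [mod q ] → ℤ.- a ≡ ℤ.- b [mod q ]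
  mod-neg {a} {b} e = subst (+ q ∣ℤ_)
    (solve 2 (λ a b → :- (a :- b) := (:- a) :- (:- b)) refl a b) (ℤ∣.∣m⇒∣-m e)

  mod-* : ∀ {a b c d} → a ≡ b [mod q ] → c ≡ d [mod q ] → a ℤ.* c ≡ b ℤ.* d [mod q ]
  mod-* {a} {b} {c} {d} e e′ = subst (+ q ∣ℤ_)
    (solve 4 (λ a b c d → (a :- b) :* c :+ b :* (c :- d) := a :* c :- b :* d) refl a b c d)
    (ℤ∣.∣m∣n⇒∣m+n (ℤ∣.∣m⇒∣m*n c e) (ℤ∣.∣n⇒∣m*n b e′))

mod-setoid : ℕ → Setoid 0ℓ 0ℓ
mod-setoid q = record
  { Carrier       = ℤ
  ; _≈_           = _≡_[mod q ]
  ; isEquivalence = record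
    { refl  = λ {a} → mod-refl {q} a
    ; sym   = λ {a} {b} → mod-sym {q} {a} {b}
    ; trans = λ {a} {b} {c} → mod-trans {q} {a} {b} {c}
    }
  }

ℤ/_ : ℕ → AbelianGroup 0ℓ 0ℓ
ℤ/ q = record
  { Carrier = ℤ
  ; _≈_     = _≡_[mod q ]
  ; _∙_     = ℤ._+_
  ; ε       = 0ℤ
  ; _⁻¹     = ℤ.-_
  ; isAbelianGroup = record
    { isGroup = record
      { isMonoid = record
        { isSemigroup = record
          { isMagma = record
            { isEquivalence = Setoid.isEquivalence (mod-setoid q)
            ; ∙-cong        = λ {a} {b} {c} {d} → mod-+ {q} {a} {b} {c} {d}
            }
          ; assoc = λ a b c → ≡⇒≡mod (ℤP.+-assoc a b c)
          }
        ; identity = (λ a → ≡⇒≡mod (ℤP.+-identityˡ a)) , (λ a → ≡⇒≡mod (ℤP.+-identityʳ a))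
        }
      ; inverse = (λ a → ≡⇒≡mod (ℤP.+-inverseˡ a)) , (λ a → ≡⇒≡mod (ℤP.+-inverseʳ a))
      ; ⁻¹-cong = λ {a} {b} → mod-neg {q} {a} {b}
      }
    ; comm = λ a b → ≡⇒≡mod (ℤP.+-comm a b)
    }
  }

^-mono-∣ : ∀ q {i j} → i ℕ.≤ j → q ℕ.^ i ∣ q ℕ.^ j
^-mono-∣ q {i} {j} i≤j = ℕ∣.divides (q ℕ.^ (j ℕ.∸ i)) (begin
  q ℕ.^ j                         ≡⟨ cong (q ℕ.^_) (ℕP.m∸n+n≡m i≤j) ⟨
  q ℕ.^ (j ℕ.∸ i ℕ.+ i)           ≡⟨ ℕP.^-distribˡ-+-* q (j ℕ.∸ i) i ⟩
  q ℕ.^ (j ℕ.∸ i) ℕ.* q ℕ.^ i     ∎)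
  where open ≡-Reasoning

mod-weaken : ∀ q {i j a b} → i ℕ.≤ j → a ≡ b [mod q ℕ.^ j ] → a ≡ b [mod q ℕ.^ i ]
mod-weaken q i≤j = ℤ∣.∣-trans (ℤ∣.∣ᵤ⇒∣ (^-mono-∣ q i≤j))

Units : CommutativeRing m n → Group (m ⊔ n) n
Units R = record
  { Carrier = ∃[ x ] ∃[ y ] x * y ≈ 1#
  ; _≈_     = λ u v → proj₁ u ≈ proj₁ v
  ; _∙_     = λ (x , x′ , e) (y , y′ , e′) → x * y , x′ * y′ ,
                trans (interchange x y x′ y′) (trans (*-cong e e′) (*-identityˡ 1#))
  ; ε       = 1# , 1# , *-identityˡ 1#
  ; _⁻¹     = λ (x , y , e) → y , x , trans (*-comm y x) e
  ; isGroup = record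
    { isMonoid = record
      { isSemigroup = record
        { isMagma = record
          { isEquivalence = record { refl = Setoid.refl setoid ; sym = sym ; trans = trans }
          ; ∙-cong        = *-cong
          }
        ; assoc = λ (x , _) (y , _) (z , _) → *-assoc x y z
        }
      ; identity = (λ (x , _) → *-identityˡ x) , (λ (x , _) → *-identityʳ x)
      }
    ; inverse = (λ (x , y , e) → trans (*-comm y x) e) , (λ (x , y , e) → e)
    ; ⁻¹-cong = λ {u} {v} → inv-cong u v
    }
  }
  where
  open CommutativeRing R
  open CommutativeSemigroupProperties *-commutativeSemigroup using (interchange)
  open SetoidReasoning setoid
  inv-cong : (u v : ∃[ x ] ∃[ y ] x * y ≈ 1#) → proj₁ u ≈ proj₁ v →
             proj₁ (proj₂ u) ≈ proj₁ (proj₂ v)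
  inv-cong (x , x′ , e) (y , y′ , e′) x≈y = begin
    x′              ≈⟨ *-identityʳ x′ ⟨
    x′ * 1#         ≈⟨ *-congˡ e′ ⟨
    x′ * (y * y′)   ≈⟨ *-assoc x′ y y′ ⟨
    (x′ * y) * y′   ≈⟨ *-congʳ (*-congˡ x≈y) ⟨
    (x′ * x) * y′   ≈⟨ *-congʳ (trans (*-comm x′ x) e) ⟩
    1# * y′         ≈⟨ *-identityˡ y′ ⟩
    y′              ∎

module _ (p : ℕ) where

  -- The inverse limit of the rings ℤ/pⁿℤ; residue n represents the
  -- image in ℤ/pⁿℤ.
  record PadicInteger : Set where
    field
      residue  : ℕ → ℤ
      coherent : ∀ {i j} → i ℕ.≤ j → residue j ≡ residue i [mod p ℕ.^ i ]

  open PadicInteger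

  Padic : CommutativeRing 0ℓ 0ℓ
  Padic = record
    { Carrier = PadicInteger
    ; _≈_     = λ x y → ∀ i → residue x i ≡ residue y i [mod p ℕ.^ i ]
    ; _+_     = λ x y → record
      { residue  = λ i → residue x i ℤ.+ residue y i
      ; coherent = λ {i} {j} i≤j → mod-+ {a = residue x j} {residue x i} {residue y j} {residue y i}
                                     (coherent x i≤j) (coherent y i≤j)
      }
    ; _*_     = λ x y → record
      { residue  = λ i → residue x i ℤ.* residue y i
      ; coherent = λ {i} {j} i≤j → mod-* {a = residue x j} {residue x i} {residue y j} {residue y i}
                                     (coherent x i≤j) (coherent y i≤j)
      }
    ; -_      = λ x → record
      { residue  = λ i → ℤ.- residue x i
      ; coherent = λ {i} {j} i≤j → mod-neg {a = residue x j} {residue x i} (coherent x i≤j)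
      }
    ; 0#      = record { residue = λ _ → 0ℤ ; coherent = λ _ → mod-refl 0ℤ }
    ; 1#      = record { residue = λ _ → 1ℤ ; coherent = λ _ → mod-refl 1ℤ }
    ; isCommutativeRing = record
      { isRing = record
        { +-isAbelianGroup = record
          { isGroup = record
            { isMonoid = record
              { isSemigroup = record
                { isMagma = record
                  { isEquivalence = record
                    { refl  = λ {x} i → mod-refl (residue x i)
                    ; sym   = λ {x} {y} e i → mod-sym {a = residue x i} {residue y i} (e i)
                    ; trans = λ {x} {y} {z} e e′ i →
                        mod-trans {a = residue x i} {residue y i} {residue z i} (e i) (e′ i)
                    }
                  ; ∙-cong = λ {x} {y} {z} {w} e e′ i →
                      mod-+ {a = residue x i} {residue y i} {residue z i} {residue w i} (e i) (e′ i)
                  }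
                ; assoc = λ x y z i → ≡⇒≡mod (ℤP.+-assoc (residue x i) (residue y i) (residue z i))
                }
              ; identity = (λ x i → ≡⇒≡mod (ℤP.+-identityˡ (residue x i)))
                         , (λ x i → ≡⇒≡mod (ℤP.+-identityʳ (residue x i)))
              }
            ; inverse = (λ x i → ≡⇒≡mod (ℤP.+-inverseˡ (residue x i)))
                      , (λ x i → ≡⇒≡mod (ℤP.+-inverseʳ (residue x i)))
            ; ⁻¹-cong = λ {x} {y} e i → mod-neg {a = residue x i} {residue y i} (e i)
            }
          ; comm = λ x y i → ≡⇒≡mod (ℤP.+-comm (residue x i) (residue y i))
          }
        ; *-cong = λ {x} {y} {z} {w} e e′ i →
            mod-* {a = residue x i} {residue y i} {residue z i} {residue w i} (e i) (e′ i)
        ; *-assoc = λ x y z i → ≡⇒≡mod (ℤP.*-assoc (residue x i) (residue y i) (residue z i))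
        ; *-identity = (λ x i → ≡⇒≡mod (ℤP.*-identityˡ (residue x i)))
                     , (λ x i → ≡⇒≡mod (ℤP.*-identityʳ (residue x i)))
        ; distrib = (λ x y z i → ≡⇒≡mod (ℤP.*-distribˡ-+ (residue x i) (residue y i) (residue z i)))
                  , (λ x y z i → ≡⇒≡mod (ℤP.*-distribʳ-+ (residue x i) (residue y i) (residue z i)))
        }
      ; *-comm = λ x y i → ≡⇒≡mod (ℤP.*-comm (residue x i) (residue y i))
      }
    }

  PadicUnits : Group 0ℓ 0ℓ
  PadicUnits = Units Padic

  unitResidue : Group.Carrier PadicUnits → ℕ → ℤ
  unitResidue u = residue (proj₁ u)

record POrientedProfiniteGroup (p : ℕ) ℓ : Set (lsuc (lsuc ℓ)) where
  field
    profiniteGroup : ProfiniteGroup ℓ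
  open ProfiniteGroup profiniteGroup public
  field
    θ              : Carrier → Group.Carrier (PadicUnits p)
    θ-homomorphism : IsGroupHomomorphism rawGroup (Group.rawGroup (PadicUnits p)) θ
    -- Continuity for the inverse limit topology on ℤₚ: all maps to the
    -- discrete rings ℤ/pⁱℤ are continuous.
    θ-continuous   : ∀ i → LocallyConstant topology (mod-setoid (p ℕ.^ i)) (λ g → unitResidue p (θ g) i)

  module θ = IsGroupHomomorphism θ-homomorphism

  θᵣ : ℕ → Carrier → ℤ
  θᵣ i g = unitResidue p (θ g) i

module _ {p : ℕ} (Gθ : POrientedProfiniteGroup p ℓ) where
  open POrientedProfiniteGroup Gθ

  -- The module ℤ/pⁱℤ(1).
  TateTwist : ℕ → DiscreteModule topologicalGroup 0ℓ
  TateTwist i = record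
    { abelianGroup = ℤ/ (p ℕ.^ i)
    ; _·_          = λ g x → θᵣ i g ℤ.* x
    ; ·-cong       = λ {g} {h} {x} {y} g≈h x≈y →
        mod-* {a = θᵣ i g} {θᵣ i h} {x} {y} (θ.⟦⟧-cong g≈h i) x≈y
    ; ·-identity   = λ x →
        mod-trans {a = θᵣ i ε ℤ.* x} {1ℤ ℤ.* x} {x}
          (mod-* {a = θᵣ i ε} {1ℤ} {x} {x} (θ.ε-homo i) (mod-refl x))
          (≡⇒≡mod (ℤP.*-identityˡ x))
    ; ·-assoc      = λ g h x →
        mod-trans {a = θᵣ i (g ∙ h) ℤ.* x} {θᵣ i g ℤ.* θᵣ i h ℤ.* x} {θᵣ i g ℤ.* (θᵣ i h ℤ.* x)}
          (mod-* {a = θᵣ i (g ∙ h)} {θᵣ i g ℤ.* θᵣ i h} {x} {x} (θ.homo g h i) (mod-refl x))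
          (≡⇒≡mod (ℤP.*-assoc (θᵣ i g) (θᵣ i h) x))
    ; ·-distrib-+  = λ g x y → ≡⇒≡mod (ℤP.*-distribˡ-+ (θᵣ i g) x y)
    ; ·-continuous = λ x g →
        let U , oU , Ug , c = θ-continuous i g
        in U , oU , Ug , λ h Uh → mod-* {a = θᵣ i h} {θᵣ i g} {x} {x} (c h Uh) (mod-refl x)
    }

  -- Reduction ℤ/pʲℤ(1) → ℤ/pⁱℤ(1), induced by the identity of ℤ.
  reduction : ∀ {i j} → i ℕ.≤ j → ModuleHom (TateTwist j) (TateTwist i)
  reduction {i} {j} i≤j = record
    { ⟦_⟧ = id
    ; isGroupHomomorphism = record
      { isMonoidHomomorphism = record
        { isMagmaHomomorphism = record
          { isRelHomomorphism = record { cong = ℤ∣.∣-trans pⁱ∣pʲ }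
          ; homo              = λ x y → mod-refl (x ℤ.+ y)
          }
        ; ε-homo = mod-refl 0ℤ
        }
      ; ⁻¹-homo = λ x → mod-refl (ℤ.- x)
      }
    ; equivariant = λ g x →
        mod-* {a = θᵣ j g} {θᵣ i g} {x} {x}
          (PadicInteger.coherent (proj₁ (θ g)) i≤j) (mod-refl x)
    }
    where
    pⁱ∣pʲ : (+ (p ℕ.^ i)) ∣ℤ (+ (p ℕ.^ j))
    pⁱ∣pʲ = ℤ∣.∣ᵤ⇒∣ (^-mono-∣ p i≤j)

  H¹-TateTwist : OpenSubgroup topologicalGroup → ℕ → AbelianGroup (lsuc ℓ) ℓ
  H¹-TateTwist H i = H¹ (restrict H (TateTwist i))

  H¹-reduction : (H : OpenSubgroup topologicalGroup) → ∀ {i j} → i ℕ.≤ j →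
                 AbelianGroup.Carrier (H¹-TateTwist H j) → AbelianGroup.Carrier (H¹-TateTwist H i)
  H¹-reduction H {i} {j} i≤j = H¹-map {M = restrict H (TateTwist j)} {N = restrict H (TateTwist i)}
                                 (restrictHom H {TateTwist j} {TateTwist i} (reduction i≤j))

  FormalHilbert90 : Set (lsuc ℓ)
  FormalHilbert90 = ∀ (H : OpenSubgroup topologicalGroup) {n} (1≤n : 1 ℕ.≤ n) →
    Surjective (AbelianGroup._≈_ (H¹-TateTwist H n)) (AbelianGroup._≈_ (H¹-TateTwist H 1))
               (H¹-reduction H {1} {n} 1≤n)

fromℤ : ℤ → ℚ
fromℤ a = a ℚ./ 1

toℚᵘ-fromℤ : ∀ a → toℚᵘ (fromℤ a) ℚᵘ.≃ mkℚᵘ a 0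
toℚᵘ-fromℤ a = ℚP.toℚᵘ-fromℚᵘ (mkℚᵘ a 0)

fromℤ-- : ∀ a b → fromℤ (a ℤ.- b) ≡ fromℤ a ℚ.- fromℤ b
fromℤ-- a b = ℚP.toℚᵘ-injective (begin
  toℚᵘ (fromℤ (a ℤ.- b))                     ≈⟨ toℚᵘ-fromℤ (a ℤ.- b) ⟩
  mkℚᵘ (a ℤ.- b) 0                           ≈⟨ *≡* (solve 2 (λ a b →
    (a :- b) :* con 1ℤ := (a :* con 1ℤ :+ (:- b) :* con 1ℤ) :* con 1ℤ) refl a b) ⟩
  mkℚᵘ a 0 ℚᵘ.+ (ℚᵘ.- mkℚᵘ b 0)              ≈⟨ ℚᵘP.+-cong (toℚᵘ-fromℤ a) (ℚᵘP.-‿cong (toℚᵘ-fromℤ b)) ⟨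
  toℚᵘ (fromℤ a) ℚᵘ.+ (ℚᵘ.- toℚᵘ (fromℤ b))  ≈⟨ ℚᵘP.+-congʳ (toℚᵘ (fromℤ a)) (ℚP.toℚᵘ-homo‿- (fromℤ b)) ⟨
  toℚᵘ (fromℤ a) ℚᵘ.+ toℚᵘ (ℚ.- fromℤ b)     ≈⟨ ℚP.toℚᵘ-homo-+ (fromℤ a) (ℚ.- fromℤ b) ⟨
  toℚᵘ (fromℤ a ℚ.- fromℤ b)                 ∎)
  where
  open SetoidReasoning ℚᵘP.≃-setoid
  open +-*-Solver

fromℤ-* : ∀ a b → fromℤ (a ℤ.* b) ≡ fromℤ a ℚ.* fromℤ b
fromℤ-* a b = ℚP.toℚᵘ-injective (begin
  toℚᵘ (fromℤ (a ℤ.* b))                     ≈⟨ toℚᵘ-fromℤ (a ℤ.* b) ⟩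
  mkℚᵘ a 0 ℚᵘ.* mkℚᵘ b 0                     ≈⟨ ℚᵘP.*-cong (toℚᵘ-fromℤ a) (toℚᵘ-fromℤ b) ⟨
  toℚᵘ (fromℤ a) ℚᵘ.* toℚᵘ (fromℤ b)         ≈⟨ ℚP.toℚᵘ-homo-* (fromℤ a) (fromℤ b) ⟨
  toℚᵘ (fromℤ a ℚ.* fromℤ b)                 ∎)
  where open SetoidReasoning ℚᵘP.≃-setoid

quotient∣ : ∀ (a c : ℤ) {q} → a ℤ.* c ≡ q → ℤ.∣ a ∣ ∣ ℤ.∣ q ∣
quotient∣ a c refl = ℕ∣.divides ℤ.∣ c ∣
  (≡.trans (ℤP.abs-* a c) (ℕP.*-comm ℤ.∣ a ∣ ℤ.∣ c ∣))

↧/∣ : ∀ a q .{{_ : ℕ.NonZero q}} → ↧ₙ (a ℚ./ q) ∣ q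
↧/∣ a q = quotient∣ (↧ (a ℚ./ q)) (gcd a (+ q)) (ℚP.↧-/ a q)

module _ {p : ℕ} (p-prime : Prime p) where

  -- ↧ₙ is the denominator in lowest terms.
  _∈ℤ₍ₚ₎ : ℚ → Set
  x ∈ℤ₍ₚ₎ = p ∤ ↧ₙ x

  infix 4 _≈ₛ_
  _≈ₛ_ : ℚ → ℚ → Set
  x ≈ₛ y = (x ℚ.- y) ∈ℤ₍ₚ₎

  open ℚSolver.+-*-Solver

  private
    instance
      p≢0 : ℕ.NonZero p
      p≢0 = prime⇒nonZero p-prime

  p∤1 : p ∤ 1
  p∤1 p∣1 = ℕP.<⇒≢ (ℕ.nonTrivial⇒n>1 p {{prime⇒nonTrivial p-prime}}) (≡.sym (ℕ∣.∣1⇒≡1 p∣1))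

  ∈-∣* : ∀ {a b d} → d ∣ a ℕ.* b → p ∤ a → p ∤ b → p ∤ d
  ∈-∣* {a} {b} d∣ab p∤a p∤b p∣d =
    [ p∤a , p∤b ]′ (euclidsLemma a b p-prime (ℕ∣.∣-trans p∣d d∣ab))

  ∈-+ : ∀ {x y} → x ∈ℤ₍ₚ₎ → y ∈ℤ₍ₚ₎ → (x ℚ.+ y) ∈ℤ₍ₚ₎
  ∈-+ {x} {y} = ∈-∣* (subst (↧ₙ (x ℚ.+ y) ∣_) (ℤP.abs-* (↧ x) (↧ y)) (quotient∣ (↧ (x ℚ.+ y)) (gcd (↥ x ℤ.* ↧ y ℤ.+ ↥ y ℤ.* ↧ x) (↧ x ℤ.* ↧ y)) (ℚP.↧-+ x y)))

  ∈-* : ∀ {x y} → x ∈ℤ₍ₚ₎ → y ∈ℤ₍ₚ₎ → (x ℚ.* y) ∈ℤ₍ₚ₎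
  ∈-* {x} {y} = ∈-∣* (subst (↧ₙ (x ℚ.* y) ∣_) (ℤP.abs-* (↧ x) (↧ y)) (quotient∣ (↧ (x ℚ.* y)) (gcd (↥ x ℤ.* ↥ y) (↧ x ℤ.* ↧ y)) (ℚP.↧-* x y)))

  ∈-neg : ∀ {x} → x ∈ℤ₍ₚ₎ → (ℚ.- x) ∈ℤ₍ₚ₎
  ∈-neg {x} = subst (p ∤_) (≡.sym (cong ℤ.∣_∣ (ℚP.↧-neg x)))

  ∈-fromℤ : ∀ a → fromℤ a ∈ℤ₍ₚ₎
  ∈-fromℤ a p∣d = p∤1 (ℕ∣.∣-trans p∣d (↧/∣ a 1))

  ≡⇒≈ₛ : ∀ {x y} → x ≡ y → x ≈ₛ y
  ≡⇒≈ₛ {x} refl = subst _∈ℤ₍ₚ₎ (≡.sym (ℚP.+-inverseʳ x)) p∤1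

  ≈ₛ-sym : ∀ {x y} → x ≈ₛ y → y ≈ₛ x
  ≈ₛ-sym {x} {y} e = subst _∈ℤ₍ₚ₎
    (solve 2 (λ x y → :- (x :- y) := y :- x) refl x y) (∈-neg {x ℚ.- y} e)

  ≈ₛ-trans : ∀ {x y z} → x ≈ₛ y → y ≈ₛ z → x ≈ₛ z
  ≈ₛ-trans {x} {y} {z} e e′ = subst _∈ℤ₍ₚ₎
    (solve 3 (λ x y z → (x :- y) :+ (y :- z) := x :- z) refl x y z)
    (∈-+ {x ℚ.- y} {y ℚ.- z} e e′)

  ≈ₛ-+ : ∀ {x y z w} → x ≈ₛ y → z ≈ₛ w → x ℚ.+ z ≈ₛ y ℚ.+ w
  ≈ₛ-+ {x} {y} {z} {w} e e′ = subst _∈ℤ₍ₚ₎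
    (solve 4 (λ x y z w → (x :- y) :+ (z :- w) := (x :+ z) :- (y :+ w)) refl x y z w)
    (∈-+ {x ℚ.- y} {z ℚ.- w} e e′)

  ≈ₛ-neg : ∀ {x y} → x ≈ₛ y → ℚ.- x ≈ₛ ℚ.- y
  ≈ₛ-neg {x} {y} e = subst _∈ℤ₍ₚ₎
    (solve 2 (λ x y → :- (x :- y) := (:- x) :- (:- y)) refl x y) (∈-neg {x ℚ.- y} e)

  ≈ₛ-scale : ∀ a {x y} → x ≈ₛ y → fromℤ a ℚ.* x ≈ₛ fromℤ a ℚ.* y
  ≈ₛ-scale a {x} {y} e = subst _∈ℤ₍ₚ₎
    (solve 3 (λ a x y → a :* (x :- y) := a :* x :- a :* y) refl (fromℤ a) x y)
    (∈-* {fromℤ a} {x ℚ.- y} (∈-fromℤ a) e)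

  ≈ₛ-setoid : Setoid 0ℓ 0ℓ
  ≈ₛ-setoid = record
    { Carrier       = ℚ
    ; _≈_           = _≈ₛ_
    ; isEquivalence = record
      { refl  = λ {x} → ≡⇒≈ₛ {x} refl
      ; sym   = λ {x} {y} → ≈ₛ-sym {x} {y}
      ; trans = λ {x} {y} {z} → ≈ₛ-trans {x} {y} {z}
      }
    }

  ℚ/ℤ₍ₚ₎ : AbelianGroup 0ℓ 0ℓ
  ℚ/ℤ₍ₚ₎ = record
    { Carrier = ℚ
    ; _≈_     = _≈ₛ_
    ; _∙_     = ℚ._+_
    ; ε       = 0ℚ
    ; _⁻¹     = ℚ.-_
    ; isAbelianGroup = record
      { isGroup = record
        { isMonoid = record
          { isSemigroup = record
            { isMagma = record
              { isEquivalence = Setoid.isEquivalence ≈ₛ-setoid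
              ; ∙-cong        = λ {x} {y} {z} {w} → ≈ₛ-+ {x} {y} {z} {w}
              }
            ; assoc = λ x y z → ≡⇒≈ₛ (ℚP.+-assoc x y z)
            }
          ; identity = (λ x → ≡⇒≈ₛ (ℚP.+-identityˡ x)) , (λ x → ≡⇒≈ₛ (ℚP.+-identityʳ x))
          }
        ; inverse = (λ x → ≡⇒≈ₛ (ℚP.+-inverseˡ x)) , (λ x → ≡⇒≈ₛ (ℚP.+-inverseʳ x))
        ; ⁻¹-cong = λ {x} {y} → ≈ₛ-neg {x} {y}
        }
      ; comm = λ x y → ≡⇒≈ₛ (ℚP.+-comm x y)
      }
    }

  -- The ℤₚ-module structure of ℚ/ℤ₍ₚ₎: x is killed by pᵛ with v the
  -- p-adic valuation of its denominator d, so z acts on it as any integer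
  -- congruent to z modulo pᵛ. As v ≤ d, the residue modulo pᵈ is one.
  infixr 7 _⊛_
  _⊛_ : PadicInteger p → ℚ → ℚ
  z ⊛ x = fromℤ (PadicInteger.residue z (↧ₙ x)) ℚ.* x

  p-part : ∀ d .{{_ : ℕ.NonZero d}} → Acc ℕ._<_ d →
           ∃[ v ] ∃[ b ] v ℕ.≤ d × p ∤ b × d ≡ p ℕ.^ v ℕ.* b
  p-part d (acc rec) with p ℕ∣.∣? d
  ... | no p∤d = 0 , d , ℕ.z≤n , p∤d , ≡.sym (ℕP.*-identityˡ d)
  ... | yes (ℕ∣.divides q refl) =
    let v , b , v≤q , p∤b , q≡ = p-part q {{q≢0}} (rec q<qp)
    in suc v , b , ℕP.≤-trans (ℕ.s≤s v≤q) q<qp , p∤b , (begin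
         q ℕ.* p                    ≡⟨ ℕP.*-comm q p ⟩
         p ℕ.* q                    ≡⟨ cong (p ℕ.*_) q≡ ⟩
         p ℕ.* (p ℕ.^ v ℕ.* b)      ≡⟨ ℕP.*-assoc p (p ℕ.^ v) b ⟨
         p ℕ.* p ℕ.^ v ℕ.* b        ∎)
    where
    open ≡-Reasoning
    q≢0 : ℕ.NonZero q
    q≢0 = ℕP.m*n≢0⇒m≢0 q
    q<qp : q ℕ.< q ℕ.* p
    q<qp = ℕP.m<m*n q p {{q≢0}} (ℕ.nonTrivial⇒n>1 p {{prime⇒nonTrivial p-prime}})

  killed : ∀ x → ∃[ v ] v ℕ.≤ ↧ₙ x × (fromℤ (+ (p ℕ.^ v)) ℚ.* x) ∈ℤ₍ₚ₎
  killed x@record{} with p-part (↧ₙ x) (<-wellFounded (↧ₙ x))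
  ... | v , zero , _ , p∤0 , _ = contradiction (p ℕ∣.∣0) p∤0
  ... | v , b@(suc b-1) , v≤d , p∤b , d≡ = v , v≤d , λ p∣ →
    p∤b (ℕ∣.∣-trans (subst (λ y → p ∣ ↧ₙ y) eq p∣) (↧/∣ (↥ x) b))
    where
    open SetoidReasoning ℚᵘP.≃-setoid
    num : (+ (p ℕ.^ v) ℤ.* ↥ x) ℤ.* + b ≡ ↥ x ℤ.* + (1 ℕ.* ↧ₙ x)
    num = R.begin
      (+ (p ℕ.^ v) ℤ.* ↥ x) ℤ.* + b     R.≡⟨ cong (ℤ._* + b) (ℤP.*-comm (+ (p ℕ.^ v)) (↥ x)) ⟩
      (↥ x ℤ.* + (p ℕ.^ v)) ℤ.* + b     R.≡⟨ ℤP.*-assoc (↥ x) (+ (p ℕ.^ v)) (+ b) ⟩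
      ↥ x ℤ.* (+ (p ℕ.^ v) ℤ.* + b)     R.≡⟨ cong (↥ x ℤ.*_) (ℤP.pos-* (p ℕ.^ v) b) ⟨
      ↥ x ℤ.* + (p ℕ.^ v ℕ.* b)         R.≡⟨ cong (λ d → ↥ x ℤ.* + d) d≡ ⟨
      ↥ x ℤ.* + (↧ₙ x)                  R.≡⟨ cong (λ d → ↥ x ℤ.* + d) (ℕP.*-identityˡ (↧ₙ x)) ⟨
      ↥ x ℤ.* + (1 ℕ.* ↧ₙ x)            R.∎
      where module R = ≡-Reasoning
    eq : fromℤ (+ (p ℕ.^ v)) ℚ.* x ≡ ↥ x ℚ./ b
    eq = ℚP.toℚᵘ-injective (begin
      toℚᵘ (fromℤ (+ (p ℕ.^ v)) ℚ.* x)           ≈⟨ ℚP.toℚᵘ-homo-* (fromℤ (+ (p ℕ.^ v))) x ⟩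
      toℚᵘ (fromℤ (+ (p ℕ.^ v))) ℚᵘ.* toℚᵘ x     ≈⟨ ℚᵘP.*-congʳ (toℚᵘ-fromℤ (+ (p ℕ.^ v))) ⟩
      mkℚᵘ (+ (p ℕ.^ v)) 0 ℚᵘ.* toℚᵘ x           ≈⟨ *≡* num ⟩
      mkℚᵘ (↥ x) b-1                             ≈⟨ ℚP.toℚᵘ-fromℚᵘ (mkℚᵘ (↥ x) b-1) ⟨
      toℚᵘ (↥ x ℚ./ b)                           ∎)

  scale-mod : ∀ x {a b} → a ≡ b [mod p ℕ.^ ↧ₙ x ] → fromℤ a ℚ.* x ≈ₛ fromℤ b ℚ.* x
  scale-mod x {a} {b} a≡b with killed x
  ... | v , v≤d , ∈ with mod-weaken p {a = a} {b} v≤d a≡b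
  ... | divides c a-b≡ = subst _∈ℤ₍ₚ₎ eq (∈-* {fromℤ c} (∈-fromℤ c) ∈)
    where
    pᵛ = + (p ℕ.^ v)
    eq : fromℤ c ℚ.* (fromℤ pᵛ ℚ.* x) ≡ fromℤ a ℚ.* x ℚ.- fromℤ b ℚ.* x
    eq = R.begin
      fromℤ c ℚ.* (fromℤ pᵛ ℚ.* x)         R.≡⟨ ℚP.*-assoc (fromℤ c) (fromℤ pᵛ) x ⟨
      fromℤ c ℚ.* fromℤ pᵛ ℚ.* x           R.≡⟨ cong (ℚ._* x) (fromℤ-* c pᵛ) ⟨
      fromℤ (c ℤ.* pᵛ) ℚ.* x               R.≡⟨ cong (λ y → fromℤ y ℚ.* x) a-b≡ ⟨
      fromℤ (a ℤ.- b) ℚ.* x                R.≡⟨ cong (ℚ._* x) (fromℤ-- a b) ⟩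
      (fromℤ a ℚ.- fromℤ b) ℚ.* x          R.≡⟨ solve 3 (λ a b x →
        (a :- b) :* x := a :* x :- b :* x) refl (fromℤ a) (fromℤ b) x ⟩
      fromℤ a ℚ.* x ℚ.- fromℤ b ℚ.* x      R.∎
      where module R = ≡-Reasoning

  open PadicInteger
  open SetoidReasoning ≈ₛ-setoid

  ⊛-stable : ∀ z x {i} → ↧ₙ x ℕ.≤ i → fromℤ (residue z i) ℚ.* x ≈ₛ z ⊛ x
  ⊛-stable z x {i} d≤i = scale-mod x {residue z i} {residue z (↧ₙ x)} (coherent z d≤i)

  ⊛-cong : ∀ {z w x y} → CommutativeRing._≈_ (Padic p) z w → x ≈ₛ y → z ⊛ x ≈ₛ w ⊛ y
  ⊛-cong {z} {w} {x} {y} z≈w x≈y = begin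
    z ⊛ x                     ≈⟨ scale-mod x {residue z (↧ₙ x)} {residue w (↧ₙ x)} (z≈w (↧ₙ x)) ⟩
    w ⊛ x                     ≈⟨ ⊛-stable w x (ℕP.m≤m+n (↧ₙ x) (↧ₙ y)) ⟨
    fromℤ (residue w N) ℚ.* x ≈⟨ ≈ₛ-scale (residue w N) {x} {y} x≈y ⟩
    fromℤ (residue w N) ℚ.* y ≈⟨ ⊛-stable w y (ℕP.m≤n+m (↧ₙ y) (↧ₙ x)) ⟩
    w ⊛ y                     ∎
    where N = ↧ₙ x ℕ.+ ↧ₙ y

  ⊛-identity : ∀ x → CommutativeRing.1# (Padic p) ⊛ x ≈ₛ x
  ⊛-identity x = ≡⇒≈ₛ (ℚP.*-identityˡ x)

  ⊛-assoc : ∀ z w x → CommutativeRing._*_ (Padic p) z w ⊛ x ≈ₛ z ⊛ (w ⊛ x)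
  ⊛-assoc z w x = begin
    fromℤ (residue z d ℤ.* residue w d) ℚ.* x
      ≈⟨ scale-mod x {residue z d ℤ.* residue w d} {residue z N ℤ.* residue w d}
           (mod-* {a = residue z d} {residue z N} {residue w d} {residue w d}
             (mod-sym {a = residue z N} {residue z d} (coherent z (ℕP.m≤m+n d d′)))
             (mod-refl (residue w d))) ⟩
    fromℤ (residue z N ℤ.* residue w d) ℚ.* x
      ≡⟨ cong (ℚ._* x) (fromℤ-* (residue z N) (residue w d)) ⟩
    fromℤ (residue z N) ℚ.* fromℤ (residue w d) ℚ.* x
      ≡⟨ ℚP.*-assoc (fromℤ (residue z N)) (fromℤ (residue w d)) x ⟩
    fromℤ (residue z N) ℚ.* (w ⊛ x)
      ≈⟨ ⊛-stable z (w ⊛ x) (ℕP.m≤n+m d′ d) ⟩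
    z ⊛ (w ⊛ x) ∎
    where
    d  = ↧ₙ x
    d′ = ↧ₙ (w ⊛ x)
    N  = d ℕ.+ d′

  ⊛-distrib-+ : ∀ z x y → z ⊛ (x ℚ.+ y) ≈ₛ z ⊛ x ℚ.+ z ⊛ y
  ⊛-distrib-+ z x y = begin
    z ⊛ (x ℚ.+ y)
      ≈⟨ ⊛-stable z (x ℚ.+ y) (ℕP.m≤n+m (↧ₙ (x ℚ.+ y)) (↧ₙ x ℕ.+ ↧ₙ y)) ⟨
    fromℤ (residue z N) ℚ.* (x ℚ.+ y)
      ≡⟨ ℚP.*-distribˡ-+ (fromℤ (residue z N)) x y ⟩
    fromℤ (residue z N) ℚ.* x ℚ.+ fromℤ (residue z N) ℚ.* y
      ≈⟨ ≈ₛ-+ {fromℤ (residue z N) ℚ.* x} {z ⊛ x} {fromℤ (residue z N) ℚ.* y} {z ⊛ y}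
           (⊛-stable z x (ℕP.≤-trans (ℕP.m≤m+n (↧ₙ x) (↧ₙ y)) (ℕP.m≤m+n _ _)))
           (⊛-stable z y (ℕP.≤-trans (ℕP.m≤n+m (↧ₙ y) (↧ₙ x)) (ℕP.m≤m+n _ _))) ⟩
    z ⊛ x ℚ.+ z ⊛ y ∎
    where N = ↧ₙ x ℕ.+ ↧ₙ y ℕ.+ ↧ₙ (x ℚ.+ y)

  module _ (Gθ : POrientedProfiniteGroup p ℓ) where
    open POrientedProfiniteGroup Gθ

    S : DiscreteModule topologicalGroup 0ℓ
    S = record
      { abelianGroup = ℚ/ℤ₍ₚ₎
      ; _·_          = λ g x → proj₁ (θ g) ⊛ x
      ; ·-cong       = λ {g} {h} {x} {y} g≈h → ⊛-cong {proj₁ (θ g)} {proj₁ (θ h)} {x} {y} (θ.⟦⟧-cong g≈h)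
      ; ·-identity   = λ x → begin
          proj₁ (θ ε) ⊛ x                   ≈⟨ ⊛-cong {proj₁ (θ ε)} {1#} {x} θ.ε-homo (≡⇒≈ₛ {x} ≡.refl) ⟩
          1# ⊛ x                            ≈⟨ ⊛-identity x ⟩
          x                                 ∎
      ; ·-assoc      = λ g h x → begin
          proj₁ (θ (g ∙ h)) ⊛ x             ≈⟨ ⊛-cong {proj₁ (θ (g ∙ h))} {proj₁ (θ g) * proj₁ (θ h)} {x}
                                                 (θ.homo g h) (≡⇒≈ₛ {x} ≡.refl) ⟩
          (proj₁ (θ g) * proj₁ (θ h)) ⊛ x   ≈⟨ ⊛-assoc (proj₁ (θ g)) (proj₁ (θ h)) x ⟩
          proj₁ (θ g) ⊛ (proj₁ (θ h) ⊛ x)   ∎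
      ; ·-distrib-+  = λ g → ⊛-distrib-+ (proj₁ (θ g))
      ; ·-continuous = λ x g →
          let U , oU , Ug , c = θ-continuous (↧ₙ x) g
          in U , oU , Ug , λ h Uh → scale-mod x {θᵣ (↧ₙ x) h} {θᵣ (↧ₙ x) g} (c h Uh)
      }
      where open CommutativeRing (Padic p) using (1#; _*_)

    record IsHilbert90Module (M : DiscreteModule topologicalGroup ℓ) : Set (lsuc ℓ) where
      open DiscreteModule M using (commutativeMonoid) renaming (Carrier to ∣M∣; _≈_ to _≈ₘ_)
      open Mult commutativeMonoid using () renaming (_×_ to _×ₘ_)
      field
        p-divisible : ∀ (x : ∣M∣) → ∃[ y ] (p ×ₘ y) ≈ₘ x
        torsion-iso : ModuleIso (primaryTorsion p M) S
        H¹-vanishes : ∀ (H : OpenSubgroup topologicalGroup) → IsTrivial (H¹ (restrict H M))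

    HasHilbert90Module : Set (lsuc ℓ)
    HasHilbert90Module = ∃[ M ] IsHilbert90Module M

{-# OPTIONS --safe #-}

-- Write S[pⁿ] for ℤ/pⁿℤ(1). If M is a Hilbert 90 module, a cocycle with values in S[p] ⊆ M
-- is the coboundary of some x = pⁿ y, and the coboundary of y is a lift to S[pⁿ⁺¹].
--
-- Conversely, formal Hilbert 90 makes H¹(H, S) p-divisible for every open H. Let I be the
-- module of functions G → S with right translation, which contains S, and let M consist of
-- the smooth elements of the quotient of lim (⋯ → I → I), with multiplication by p as
-- transition maps, by its submodule Tₚ(S). Then M is p-divisible, M{p} = S, and M/S is a
-- ℚ-vector space. Averaging a cocycle of M over its finitely many values therefore makes
-- it cohomologous to a cocycle α of S. Successive p-th roots of α are coboundaries of
-- functions on G, and these functions form an element of M whose coboundary is α.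
module Submission where

open import Algebra.Bundles using (AbelianGroup)
open import Algebra.Morphism.Structures using (IsGroupIsomorphism)
import Algebra.Properties.AbelianGroup as AbelianGroupProperties
import Algebra.Properties.CommutativeMonoid.Mult as Mult
import Algebra.Properties.CommutativeMonoid.Sum as Sum
import Algebra.Properties.CommutativeSemigroup as CommutativeSemigroupProperties
import Algebra.Properties.Group as GroupProperties
open import Axiom.ExcludedMiddle using (ExcludedMiddle)
open import Data.Fin.Base using (Fin; zero; suc)
import Data.Fin.Permutation as Permutation
open import Data.Fin.Properties using (any?)
open import Data.Integer as ℤ using (ℤ; +_; 0ℤ; 1ℤ)
open import Data.Integer.Divisibility.Signed using (divides) renaming (_∣_ to _∣ℤ_)
import Data.Integer.Properties as ℤP
open import Data.Integer.Solver using () renaming (module +-*-Solver to ℤ-Solver)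
open import Data.List.Base using (List; []; _∷_; map)
open import Data.List.Relation.Unary.Any as Any using (Any; here; there)
import Data.List.Relation.Unary.Any.Properties as AnyP
open import Data.Nat as ℕ using (ℕ; zero; suc)
open import Data.Nat.Coprimality using (Coprime; coprime-Bézout; coprime-divisor)
open import Data.Nat.Divisibility as ℕ∣ using (_∤_)
open import Data.Nat.GCD using (module Bézout)
open import Data.Nat.Induction using (<-wellFounded)
open import Data.Nat.Primality using (Prime; prime⇒nonZero; prime⇒irreducible)
import Data.Nat.Properties as ℕP
open import Data.Product using (Σ; ∃-syntax; _×_; _,_; proj₁; proj₂)
open import Data.Rational as ℚ using (ℚ; 0ℚ; 1ℚ; ↥_; ↧_; ↧ₙ_; toℚᵘ)
import Data.Rational.Properties as ℚP
open import Data.Rational.Solver using () renaming (module +-*-Solver to ℚ-Solver)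
open import Data.Rational.Unnormalised as ℚᵘ using (mkℚᵘ; *≡*)
import Data.Rational.Unnormalised.Properties as ℚᵘP
open import Data.Sum.Base using (inj₁; inj₂)
open import Data.Unit.Polymorphic using (⊤; tt)
open import Function.Base using (_∘_; id)
open import Function.Bundles using (_⇔_; mk⇔; Equivalence)
open import Function.Definitions using (Surjective)
open import Level using (Level; _⊔_; 0ℓ; Lift; lift; lower) renaming (suc to lsuc)
open import Relation.Binary.Bundles using (Setoid)
open import Relation.Binary.PropositionalEquality as ≡ using (_≡_; refl; cong; subst; module ≡-Reasoning)
import Relation.Binary.Reasoning.Setoid as SetoidReasoning
open import Relation.Nullary using (Dec; yes; no; contradiction)
open import Relation.Nullary.Decidable using (True; toWitness; fromWitness; map′)
open import Relation.Unary using (Pred)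
open import Defs

-- The obstacle is continuity. Each chosen p-th root α_j of a cocycle α of S is locally constant,
-- but the neighbourhoods of the identity on which α_j vanishes may shrink as j grows, so the tower
-- of functions bounding the α_j need not have an open stabilizer in lim I. Where α vanishes at g,
-- however, translation by g changes this tower only by the sequence of the α_j(g), which lies in
-- Tₚ(S). This is why the quotient by Tₚ(S) is taken. The limit lim I is itself a ℚ-vector space: a
-- shift of levels divides by p, and integers prime to p act invertibly on S. Dividing by Tₚ(S)
-- therefore creates exactly the torsion lim S / Tₚ(S), which is S because S is p-divisible.
-- Excluded middle decides equality of values and membership in H, so that compactness yields finite
-- enumerations of values and cosets; it also brings smoothness down to the universe in which M has
-- to live.

private
  variable
    ℓ m n : Level

-- Topological groups

module _ (G : TopologicalGroup ℓ) where
  open TopologicalGroup G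

  open-local : {W : Pred Carrier ℓ} →
    (∀ x → W x → ∃[ V ] Open V × V x × (∀ y → V y → W y)) → Open W
  open-local {W} nbhd = open-ext
    (λ y → mk⇔ (λ ((x , Wx) , Vy) → proj₂ (proj₂ (proj₂ (nbhd x Wx))) y Vy)
               (λ Wy → (y , Wy) , proj₁ (proj₂ (proj₂ (nbhd y Wy)))))
    (open-⋃ {I = Σ Carrier W} (λ (x , Wx) → proj₁ (nbhd x Wx))
                              (λ (x , Wx) → proj₁ (proj₂ (nbhd x Wx))))

  translateʳ-open : ∀ g {U} → Open U → Open (λ x → U (x ∙ g))
  translateʳ-open g oU = open-local λ x Uxg →
    let V , W , oV , _ , Vx , Wg , VW⊆U = ∙-continuous oU Uxg
    in V , oV , Vx , λ y Vy → VW⊆U y g Vy Wg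

  translateˡ-open : ∀ g {U} → Open U → Open (λ x → U (g ∙ x))
  translateˡ-open g oU = open-local λ x Ugx →
    let V , W , _ , oW , Vg , Wx , VW⊆U = ∙-continuous oU Ugx
    in W , oW , Wx , λ y Wy → VW⊆U g y Vg Wy

  whole : OpenSubgroup G
  whole = record
    { member    = λ _ → ⊤
    ; isOpen    = open-univ
    ; ε-closed  = tt
    ; ∙-closed  = λ _ _ → tt
    ; ⁻¹-closed = λ _ → tt
    }

  module _ (H : OpenSubgroup G) where
    open OpenSubgroup H

    leftCosets : Setoid ℓ ℓ
    leftCosets = record
      { Carrier       = Carrier
      ; _≈_           = λ x y → member (x ⁻¹ ∙ y)
      ; isEquivalence = record
        { refl  = resp (sym (inverseˡ _)) ε-closed
        ; sym   = λ {x} {y} Hxy → resp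
            (trans (⁻¹-anti-homo-∙ (x ⁻¹) y) (∙-congˡ (⁻¹-involutive x))) (⁻¹-closed Hxy)
        ; trans = λ {x} {y} {z} Hxy Hyz → resp
            (trans (assoc (x ⁻¹) y (y ⁻¹ ∙ z)) (∙-congˡ (\\-leftDividesˡ y z)))
            (∙-closed Hxy Hyz)
        }
      }
      where
      open GroupProperties group using (⁻¹-anti-homo-∙; ⁻¹-involutive; \\-leftDividesˡ)
      resp = open-resp-≈ isOpen

    leftCoset-open : ∀ x → Open (λ y → member (x ⁻¹ ∙ y))
    leftCoset-open x = translateˡ-open (x ⁻¹) isOpen

-- Finiteness

-- An enumeration of the image without repetition: by `unique`, distinct indices carry distinct
-- values, so `size` counts the values and a self-map of the image becomes a map of indices.
record Values (B : Setoid m n) {X : Set ℓ} (f : X → Setoid.Carrier B) : Set (ℓ ⊔ n) where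
  open Setoid B
  field
    size   : ℕ
    rep    : Fin size → X
    idx    : X → Fin size
    f-rep  : ∀ x → f (rep (idx x)) ≈ f x
    unique : ∀ {x i} → f (rep i) ≈ f x → idx x ≡ i

  idx-cong : ∀ {x y} → f x ≈ f y → idx x ≡ idx y
  idx-cong {x} {y} e = unique (trans (f-rep y) (sym e))

module _ (B : Setoid m n) (_≟_ : ∀ x y → Dec (Setoid._≈_ B x y))
         {X : Set ℓ} (f : X → Setoid.Carrier B) where
  open Setoid B renaming (refl to ≈-refl)

  irredundant : ∀ xs → ∃[ k ] Σ (Fin k → X) λ r →
    (∀ i j → f (r i) ≈ f (r j) → i ≡ j) ×
    (∀ y → Any (λ x → f x ≈ f y) xs → ∃[ i ] f (r i) ≈ f y)
  irredundant [] = 0 , (λ ()) , (λ ()) , λ _ ()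
  irredundant (x ∷ xs) with irredundant xs
  ... | k , r , inj , cov with any? (λ i → f (r i) ≟ f x)
  ... | yes (i , ri≈x) = k , r , inj ,
        λ { y (here x≈y) → i , trans ri≈x x≈y ; y (there a) → cov y a }
  ... | no new = suc k , r′ , inj′ , cov′
    where
    r′ : Fin (suc k) → X
    r′ zero    = x
    r′ (suc i) = r i
    inj′ : ∀ i j → f (r′ i) ≈ f (r′ j) → i ≡ j
    inj′ zero    zero    _ = ≡.refl
    inj′ zero    (suc j) e = contradiction (j , sym e) new
    inj′ (suc i) zero    e = contradiction (i , e) new
    inj′ (suc i) (suc j) e = cong suc (inj i j e)
    cov′ : ∀ y → Any (λ z → f z ≈ f y) (x ∷ xs) → ∃[ i ] f (r′ i) ≈ f y
    cov′ y (here e)  = zero , e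
    cov′ y (there a) = let i , e = cov y a in suc i , e

  values : ∀ xs → (∀ y → Any (λ x → f x ≈ f y) xs) → Values B f
  values xs cov with irredundant xs
  ... | k , r , inj , hit = record
    { size   = k
    ; rep    = r
    ; idx    = λ x → proj₁ (hit x (cov x))
    ; f-rep  = λ x → proj₂ (hit x (cov x))
    ; unique = λ {x} {i} e → inj _ _ (trans (proj₂ (hit x (cov x))) (sym e))
    }

module _ (em : ExcludedMiddle (lsuc ℓ)) where

  em↓ : ExcludedMiddle ℓ
  em↓ {P} = map′ lower lift (em {Lift (lsuc ℓ) P})

  module _ {G : TopologicalGroup ℓ} (compact : TopologicalGroup.Compact G)
           (H : OpenSubgroup G) where
    private
      module G = TopologicalGroup G
      module H = TopologicalGroup (asTopologicalGroup H)
    open OpenSubgroup H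

    -- Compactness is applied to the covering of G by neighbourhoods, inside H, on
    -- which f is constant, together with the cosets other than H.
    finitelyManyValues : (B : Setoid m m) {f : H.Carrier → Setoid.Carrier B} →
      LocallyConstant H.topology B f →
      Σ (List H.Carrier) λ xs → ∀ y → Any (λ x → Setoid._≈_ B (f x) (f y)) xs
    finitelyManyValues B {f} f-lc =
      let xs , cov = compact (λ x → U x em↓) (λ x → U-open x em↓) (λ x → x , U-self x em↓)
      in map (λ x → pt x em↓) xs ,
         λ y → AnyP.map⁺ (Any.map (λ {x} → val x em↓ y) (cov (proj₁ y)))
      where
      open Setoid B
      U : ∀ x → Dec (member x) → Pred G.Carrier ℓ
      U x (yes Hx) = proj₁ (proj₁ (proj₂ (f-lc (x , Hx))))
      U x (no _)   = λ y → member (x G.⁻¹ G.∙ y)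
      U-open : ∀ x d → G.Open (U x d)
      U-open x (yes Hx) = proj₁ (proj₂ (proj₁ (proj₂ (f-lc (x , Hx)))))
      U-open x (no _)   = leftCoset-open G H x
      U-self : ∀ x d → U x d x
      U-self x (yes Hx) =
        let _ , (_ , _ , W⇔V) , Wx , _ = f-lc (x , Hx)
        in Equivalence.to (W⇔V (x , Hx)) Wx
      U-self x (no _)   = Setoid.refl (leftCosets G H)
      pt : ∀ x → Dec (member x) → H.Carrier
      pt x (yes Hx) = x , Hx
      -- Any element of H serves as the default: for x outside H the coset xH contains no point of
      -- H, so this case never has to account for a value.
      pt x (no _)   = H.ε
      val : ∀ x d y → U x d (proj₁ y) → f (pt x d) ≈ f y
      val x (yes Hx) y Uy =
        let _ , (_ , _ , W⇔V) , _ , const = f-lc (x , Hx)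
        in sym (const y (Equivalence.from (W⇔V y) Uy))
      val x (no ¬Hx) (y , Hy) Uy = contradiction Hx ¬Hx
        where
        open GroupProperties G.group using (⁻¹-involutive; ⁻¹-anti-homo-∙)
        Hx : member x
        Hx = G.open-resp-≈ isOpen
          (G.trans (G.∙-congˡ (G.trans (⁻¹-anti-homo-∙ (x G.⁻¹) y) (G.∙-congˡ (⁻¹-involutive x))))
            (G.trans (G.sym (G.assoc _ _ _)) (G.trans (G.∙-congʳ (G.inverseʳ y)) (G.identityˡ x))))
          (∙-closed Hy (⁻¹-closed Uy))

-- Discrete modules

module _ {G : TopologicalGroup ℓ} (M : DiscreteModule G m) where
  private module G = TopologicalGroup G
  open DiscreteModule M
  open Mult commutativeMonoid using (×-congʳ; ×-distrib-+) renaming (_×_ to infixl 7 _×ₘ_)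
  open SetoidReasoning setoid
  open CommutativeSemigroupProperties commutativeSemigroup using (x∙yz≈y∙xz)

  scale : ℕ → ModuleHom M M
  scale k = record
    { ⟦_⟧ = k ×ₘ_
    ; isGroupHomomorphism = record
      { isMonoidHomomorphism = record
        { isMagmaHomomorphism = record
          { isRelHomomorphism = record { cong = ×-congʳ k }
          ; homo              = λ x y → ×-distrib-+ x y k
          }
        ; ε-homo = ×-zero 0 M k
        }
      ; ⁻¹-homo = ×-neg 0 M k
      }
    ; equivariant = ×-· 0 M k
    }

  ∂-cong : ∀ {x y} → x ≈ y → ∀ g → ∂ M x g ≈ ∂ M y g
  ∂-cong e g = +-cong (·-cong G.refl e) (-‿cong e)

  coboundary : Carrier → Cocycle M
  coboundary x = record
    { ⟦_⟧        = ∂ M x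
    ; ⟦⟧-cong    = λ g≈h → +-congʳ (·-cong g≈h (Setoid.refl setoid))
    ; continuous = λ g →
        let U , oU , Ug , c = ·-continuous x g in U , oU , Ug , λ y Uy → +-congʳ (c y Uy)
    ; cocycle    = λ g h → begin
        (g G.∙ h) · x + - x                     ≈⟨ +-congʳ (·-assoc g h x) ⟩
        g · (h · x) + - x                       ≈⟨ +-congʳ (·-cong G.refl (cancel x (h · x))) ⟨
        g · (x + (h · x + - x)) + - x           ≈⟨ +-congʳ (·-distrib-+ g _ _) ⟩
        g · x + g · (h · x + - x) + - x         ≈⟨ +-assoc _ _ _ ⟩
        g · x + (g · (h · x + - x) + - x)       ≈⟨ +-congˡ (+-comm _ _) ⟩
        g · x + (- x + g · (h · x + - x))       ≈⟨ +-assoc _ _ _ ⟨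
        g · x + - x + g · (h · x + - x)         ∎
    }
    where
    cancel : ∀ x y → x + (y + - x) ≈ y
    cancel x y = begin
      x + (y + - x)  ≈⟨ x∙yz≈y∙xz x y (- x) ⟩
      y + (x + - x)  ≈⟨ +-congˡ (-‿inverseʳ x) ⟩
      y + 0#         ≈⟨ +-identityʳ y ⟩
      y              ∎

  ⟦ε⟧≈0 : ∀ (c : Cocycle M) → Cocycle.⟦_⟧ c G.ε ≈ 0#
  ⟦ε⟧≈0 c = identityʳ-unique (⟦ G.ε ⟧) (⟦ G.ε ⟧) (sym (begin
    ⟦ G.ε ⟧                     ≈⟨ ⟦⟧-cong (G.identityˡ G.ε) ⟨
    ⟦ G.ε G.∙ G.ε ⟧             ≈⟨ cocycle G.ε G.ε ⟩
    ⟦ G.ε ⟧ + G.ε · ⟦ G.ε ⟧     ≈⟨ +-congˡ (·-identity _) ⟩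
    ⟦ G.ε ⟧ + ⟦ G.ε ⟧           ∎))
    where
    open Cocycle c
    open AbelianGroupProperties abelianGroup using (identityʳ-unique)

  open Sum commutativeMonoid using (sum; sum-permute; sum-cong-≋; ∑-distrib-+; sum-replicate)

  ·-sum : ∀ g {k} (v : Fin k → Carrier) → g · sum v ≈ sum (λ i → g · v i)
  ·-sum g {zero}  v = ·-zero g
  ·-sum g {suc k} v = trans (·-distrib-+ g _ _) (+-congˡ (·-sum g (v ∘ suc)))

  -- The affine maps v ↦ c g + g · v permute the values of a cocycle c, so they fix the
  -- sum x of these values up to the N-fold c g, where N is the number of values.
  averaging : (c : Cocycle M) (vs : Values setoid (Cocycle.⟦_⟧ c)) →
    ∃[ x ] ∀ g → Values.size vs ×ₘ Cocycle.⟦_⟧ c g ≈ ∂ M x g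
  -- The sign: `fixed` says that N c(g) = x - g · x, which is the coboundary of - x.
  averaging c vs = - x , λ g → begin
    size ×ₘ ⟦ g ⟧                              ≈⟨ +-identityʳ _ ⟨
    size ×ₘ ⟦ g ⟧ + 0#                         ≈⟨ +-congˡ (-‿inverseʳ (g · x)) ⟨
    size ×ₘ ⟦ g ⟧ + (g · x + - (g · x))        ≈⟨ +-assoc _ _ _ ⟨
    size ×ₘ ⟦ g ⟧ + g · x + - (g · x)          ≈⟨ +-congʳ (fixed g) ⟨
    x + - (g · x)                              ≈⟨ +-comm _ _ ⟩
    - (g · x) + x                              ≈⟨ +-cong (sym (·-neg g x)) (sym (⁻¹-involutive x)) ⟩
    g · (- x) + - - x                          ∎
    where
    open Cocycle c
    open Values vs
    open AbelianGroupProperties abelianGroup using (⁻¹-involutive)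
    x = sum (⟦_⟧ ∘ rep)
    -- Left translation acts on the set of values, since c(g ∙ h) depends on h only through c(h).
    σ : G.Carrier → Fin size → Fin size
    σ g i = idx (g G.∙ rep i)
    translate : ∀ g {h k} → ⟦ h ⟧ ≈ ⟦ k ⟧ → ⟦ g G.∙ h ⟧ ≈ ⟦ g G.∙ k ⟧
    translate g {h} {k} e = begin
      ⟦ g G.∙ h ⟧         ≈⟨ cocycle g h ⟩
      ⟦ g ⟧ + g · ⟦ h ⟧   ≈⟨ +-congˡ (·-cong G.refl e) ⟩
      ⟦ g ⟧ + g · ⟦ k ⟧   ≈⟨ cocycle g k ⟨
      ⟦ g G.∙ k ⟧         ∎
    σ-inverse : ∀ g h → g G.∙ h G.≈ G.ε → ∀ i → σ g (σ h i) ≡ i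
    σ-inverse g h gh≈ε i = unique (sym (begin
      ⟦ g G.∙ rep (σ h i) ⟧        ≈⟨ translate g (f-rep (h G.∙ rep i)) ⟩
      ⟦ g G.∙ (h G.∙ rep i) ⟧      ≈⟨ ⟦⟧-cong (G.assoc g h (rep i)) ⟨
      ⟦ g G.∙ h G.∙ rep i ⟧        ≈⟨ ⟦⟧-cong (G.trans (G.∙-congʳ gh≈ε) (G.identityˡ (rep i))) ⟩
      ⟦ rep i ⟧                    ∎))
    π : G.Carrier → Permutation.Permutation size size
    π g = Permutation.permutation (σ g) (σ (g G.⁻¹))
      (σ-inverse g (g G.⁻¹) (G.inverseʳ g)) (σ-inverse (g G.⁻¹) g (G.inverseˡ g))
    fixed : ∀ g → x ≈ size ×ₘ ⟦ g ⟧ + g · x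
    fixed g = begin
      x                                                   ≈⟨ sum-permute (⟦_⟧ ∘ rep) (π g) ⟩
      sum (λ i → ⟦ rep (σ g i) ⟧)                         ≈⟨ sum-cong-≋ (λ i →
                                                               trans (f-rep _) (cocycle g (rep i))) ⟩
      sum (λ i → ⟦ g ⟧ + g · ⟦ rep i ⟧)                   ≈⟨ ∑-distrib-+ {size} (λ _ → ⟦ g ⟧) _ ⟩
      sum {size} (λ _ → ⟦ g ⟧) + sum (λ i → g · ⟦ rep i ⟧) ≈⟨ +-cong (sum-replicate size) (sym (·-sum g (⟦_⟧ ∘ rep))) ⟩
      size ×ₘ ⟦ g ⟧ + g · x                               ∎

module _ {G : TopologicalGroup ℓ} {M : DiscreteModule G m} {N : DiscreteModule G n} where
  private
    module G = TopologicalGroup G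
    module M = DiscreteModule M
    module N = DiscreteModule N
    module M× = Mult M.commutativeMonoid
    module N× = Mult N.commutativeMonoid

  module _ (φ : ModuleHom M N) where
    open ModuleHom φ
    open SetoidReasoning N.setoid

    hom-× : ∀ k x → ⟦ k M×.× x ⟧ N.≈ k N×.× ⟦ x ⟧
    hom-× zero    x = ε-homo
    hom-× (suc k) x = N.trans (homo _ _) (N.+-congˡ (hom-× k x))

    hom-∂ : ∀ x g → ⟦ ∂ M x g ⟧ N.≈ ∂ N ⟦ x ⟧ g
    hom-∂ x g = N.trans (homo _ _) (N.+-cong (equivariant g x) (⁻¹-homo x))

    module _ (injective : ∀ {x y} → ⟦ x ⟧ N.≈ ⟦ y ⟧ → x M.≈ y) where

      -- The preimages `b g` may be chosen separately for each g: injectivity carries congruence,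
      -- local constancy and the cocycle identity over from `c`.
      lift-cocycle : (c : Cocycle N) (b : G.Carrier → M.Carrier) →
                     (∀ g → ⟦ b g ⟧ N.≈ Cocycle.⟦_⟧ c g) → Cocycle M
      lift-cocycle c b e = record
        { ⟦_⟧        = b
        ; ⟦⟧-cong    = λ {g} {h} g≈h →
            injective (N.trans (e g) (N.trans (c.⟦⟧-cong g≈h) (N.sym (e h))))
        ; continuous = λ g →
            let U , oU , Ug , const = c.continuous g
            in U , oU , Ug , λ h Uh →
                 injective (N.trans (e h) (N.trans (const h Uh) (N.sym (e g))))
        ; cocycle    = λ g h → injective (begin
            ⟦ b (g G.∙ h) ⟧               ≈⟨ e (g G.∙ h) ⟩
            c.⟦ g G.∙ h ⟧                 ≈⟨ c.cocycle g h ⟩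
            c.⟦ g ⟧ N.+ g N.· c.⟦ h ⟧     ≈⟨ N.+-cong (e g) (N.·-cong G.refl (e h)) ⟨
            ⟦ b g ⟧ N.+ g N.· ⟦ b h ⟧     ≈⟨ N.+-congˡ (equivariant g (b h)) ⟨
            ⟦ b g ⟧ N.+ ⟦ g M.· b h ⟧     ≈⟨ homo _ _ ⟨
            ⟦ b g M.+ g M.· b h ⟧         ∎)
        }
        where module c = Cocycle c

-- Divisibility and the reduction to torsion cocycles

module _ {G : TopologicalGroup ℓ} (M : DiscreteModule G m) where
  open DiscreteModule M
  open Mult commutativeMonoid using (×-congʳ; ×-assocˡ; ×-homo-1; ×-distrib-+) renaming (_×_ to infixl 7 _×ₘ_)
  open SetoidReasoning setoid

  Divisible : ℕ → Set m
  Divisible k = ∀ x → ∃[ y ] k ×ₘ y ≈ x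

  *-divisible : ∀ j k → Divisible j → Divisible k → Divisible (j ℕ.* k)
  *-divisible j k j-div k-div x =
    let y , jy≈x = j-div x
        z , kz≈y = k-div y
    in z , (begin
      (j ℕ.* k) ×ₘ z   ≈⟨ ×-assocˡ z j k ⟨
      j ×ₘ (k ×ₘ z)    ≈⟨ ×-congʳ j kz≈y ⟩
      j ×ₘ y           ≈⟨ jy≈x ⟩
      x                ∎)

  ^-divisible : ∀ p → Divisible p → ∀ k → Divisible (p ℕ.^ k)
  ^-divisible p div zero    x = x , ×-homo-1 x
  ^-divisible p div (suc k) = *-divisible p (p ℕ.^ k) div (^-divisible p div k)

  TorsionFree : ℕ → Set m
  TorsionFree k = ∀ x → k ×ₘ x ≈ 0# → x ≈ 0#

  open Cocycle

  H¹-Divisible : ℕ → Set (lsuc ℓ ⊔ m)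
  H¹-Divisible k = ∀ (α : Cocycle M) → Σ (Cocycle M) λ β → ∃[ y ] ∀ g →
    k ×ₘ ⟦ β ⟧ g ≈ ⟦ α ⟧ g + ∂ M y g

  module _ (c : Cocycle M) (vs : Values setoid (⟦ c ⟧)) where
    private N = Values.size vs

    -- Averaging gives N c = ∂ x. With N y = x, the cocycle c - ∂ y is killed by N, so only cocycles
    -- with torsion values remain to be bounded. The summand `0#` in the conclusion matches the
    -- relation of c to the zero cocycle in H¹.
    reduction-to-torsion : Divisible N →
      (∀ c′ → (∀ g → N ×ₘ ⟦ c′ ⟧ g ≈ 0#) → ∃[ y ] ∀ g → ⟦ c′ ⟧ g ≈ ∂ M y g) →
      ∃[ y ] ∀ g → ⟦ c ⟧ g ≈ 0# + ∂ M y g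
    reduction-to-torsion N-div trivial =
      let x , Nc≈∂x = averaging M c vs
          y , Ny≈x = N-div x
          c′ = _⊕_ M c (⊖_ M (coboundary M y))
          z , c′≈∂z = trivial c′ λ g → begin
            N ×ₘ (⟦ c ⟧ g + - ∂ M y g)          ≈⟨ ×-distrib-+ _ _ N ⟩
            N ×ₘ ⟦ c ⟧ g + N ×ₘ (- ∂ M y g)     ≈⟨ +-cong (Nc≈∂x g) (×-neg 0 M N _) ⟩
            ∂ M x g + - (N ×ₘ ∂ M y g)          ≈⟨ +-congˡ (-‿cong (hom-∂ {M = M} {M} (scale M N) y g)) ⟩
            ∂ M x g + - ∂ M (N ×ₘ y) g          ≈⟨ +-congˡ (-‿cong (∂-cong M Ny≈x g)) ⟩
            ∂ M x g + - ∂ M x g                 ≈⟨ -‿inverseʳ _ ⟩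
            0#                                  ∎
      in z + y , λ g → begin
        ⟦ c ⟧ g                                 ≈⟨ //-rightDividesˡ (∂ M y g) (⟦ c ⟧ g) ⟨
        ⟦ c ⟧ g + - ∂ M y g + ∂ M y g           ≈⟨ +-congʳ (c′≈∂z g) ⟩
        ∂ M z g + ∂ M y g                       ≈⟨ ∂-+ M z y g ⟨
        ∂ M (z + y) g                           ≈⟨ +-identityˡ _ ⟨
        0# + ∂ M (z + y) g                      ∎
      where open AbelianGroupProperties abelianGroup using (//-rightDividesˡ)

-- The module of towers

module TowerModule {ℓ} (em : ExcludedMiddle (lsuc ℓ)) (p : ℕ)
                   {G : TopologicalGroup ℓ} (A : DiscreteModule G 0ℓ) where
  private
    module G = TopologicalGroup G
    module A = DiscreteModule A
  open A using (_≈_; _+_; -_; _·_; 0#; +-cong; +-congˡ; +-congʳ; ·-cong; sym; trans)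
  open Mult A.commutativeMonoid using (×-congʳ; ×-distrib-+; ×-assocˡ; ×-congˡ; ×-homo-1)
    renaming (_×_ to infixl 7 _×ₐ_)
  open SetoidReasoning A.setoid
  open AbelianGroupProperties A.abelianGroup using (⁻¹-∙-comm; ε⁻¹≈ε)
  open CommutativeSemigroupProperties A.commutativeSemigroup using (interchange)

  -- A embeds into the functions G → A, on which g acts by right translation, as the
  -- functions h ↦ h · s.
  infix 4 _≐_
  _≐_ : (φ ψ : G.Carrier → A.Carrier) → Set ℓ
  φ ≐ ψ = ∃[ s ] ∀ h → φ h ≈ ψ h + h · s

  ≈⇒≐ : ∀ {φ ψ} → (∀ h → φ h ≈ ψ h) → φ ≐ ψ
  ≈⇒≐ e = 0# , λ h → trans (e h) (sym (trans (+-congˡ (A.·-zero h)) (A.+-identityʳ _)))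

  ≐-sym : ∀ {φ ψ} → φ ≐ ψ → ψ ≐ φ
  ≐-sym {φ} {ψ} (s , e) = - s , λ h → sym (begin
    φ h + h · (- s)             ≈⟨ +-cong (e h) (A.·-neg h s) ⟩
    ψ h + h · s + - (h · s)     ≈⟨ A.+-assoc _ _ _ ⟩
    ψ h + (h · s + - (h · s))   ≈⟨ +-congˡ (A.-‿inverseʳ _) ⟩
    ψ h + 0#                    ≈⟨ A.+-identityʳ _ ⟩
    ψ h                         ∎)

  ≐-trans : ∀ {φ ψ χ} → φ ≐ ψ → ψ ≐ χ → φ ≐ χ
  ≐-trans {φ} {ψ} {χ} (s , e) (t , e′) = t + s , λ h → begin
    φ h                      ≈⟨ e h ⟩
    ψ h + h · s              ≈⟨ +-congʳ (e′ h) ⟩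
    χ h + h · t + h · s      ≈⟨ A.+-assoc _ _ _ ⟩
    χ h + (h · t + h · s)    ≈⟨ +-congˡ (A.·-distrib-+ h t s) ⟨
    χ h + h · (t + s)        ∎

  ≐-+ : ∀ {φ φ′ ψ ψ′} → φ ≐ φ′ → ψ ≐ ψ′ → (λ h → φ h + ψ h) ≐ (λ h → φ′ h + ψ′ h)
  ≐-+ (s , e) (t , e′) = s + t , λ h →
    trans (+-cong (e h) (e′ h))
      (trans (interchange _ _ _ _) (+-congˡ (sym (A.·-distrib-+ h s t))))

  ≐-map : (φ : ModuleHom A A) → let open ModuleHom φ in
          ∀ {ψ χ} → ψ ≐ χ → (λ h → ⟦ ψ h ⟧) ≐ (λ h → ⟦ χ h ⟧)
  ≐-map φ (s , e) = ⟦ s ⟧ , λ h →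
    trans (⟦⟧-cong (e h)) (trans (homo _ _) (+-congˡ (equivariant h s)))
    where open ModuleHom φ

  ≐-act : ∀ g {φ ψ} → φ ≐ ψ → (λ h → φ (h G.∙ g)) ≐ (λ h → ψ (h G.∙ g))
  ≐-act g (s , e) = g · s , λ h → trans (e (h G.∙ g)) (+-congˡ (A.·-assoc h g s))

  -- The element s with φ h = h · s is recovered by evaluating at the identity.
  ≐0⇒≈· : ∀ {φ} → φ ≐ (λ _ → 0#) → ∀ h → φ h ≈ h · φ G.ε
  ≐0⇒≈· {φ} (s , e) h = begin
    φ h               ≈⟨ e h ⟩
    0# + h · s        ≈⟨ A.+-identityˡ _ ⟩
    h · s             ≈⟨ ·-cong G.refl (trans (sym (A.·-identity s)) (sym (A.+-identityˡ _))) ⟩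
    h · (0# + G.ε · s) ≈⟨ ·-cong G.refl (e G.ε) ⟨
    h · φ G.ε         ∎

  ≈·⇒≐0 : ∀ {φ} s → (∀ h → φ h ≈ h · s) → φ ≐ (λ _ → 0#)
  ≈·⇒≐0 s e = s , λ h → trans (e h) (sym (A.+-identityˡ _))

  record Tower : Set ℓ where
    field
      at      : ℕ → G.Carrier → A.Carrier
      at-cong : ∀ i {g h} → g G.≈ h → at i g ≈ at i h
      at-p    : ∀ i g → p ×ₐ at (suc i) g ≈ at i g

  open Tower

  -- Congruence modulo pⁱ Tₚ(A). By `congruent` the difference at level j is h ↦ h · s_j; evaluating
  -- at the identity shows that the s_j form a compatible sequence, and `equal` says that s_i = 0.
  -- For i = 0 this is the equality of the quotient by Tₚ(A).
  infix 4 _≈[_]_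
  record _≈[_]_ (f : Tower) (i : ℕ) (f′ : Tower) : Set ℓ where
    constructor _&_
    field
      equal     : ∀ g → at f i g ≈ at f′ i g
      congruent : ∀ j → at f j ≐ at f′ j

  open _≈[_]_

  pointwise-≈ : ∀ {f f′} → (∀ j g → at f j g ≈ at f′ j g) → ∀ i → f ≈[ i ] f′
  pointwise-≈ e i = e i & λ j → ≈⇒≐ (e j)

  towers : ℕ → Setoid ℓ ℓ
  towers i = record
    { Carrier       = Tower
    ; _≈_           = _≈[ i ]_
    ; isEquivalence = record
      { refl  = λ {f} → pointwise-≈ (λ _ _ → A.refl) i
      ; sym   = λ (e & d) → (λ g → sym (e g)) & λ j → ≐-sym (d j)
      ; trans = λ (e & d) (e′ & d′) → (λ g → trans (e g) (e′ g)) & λ j → ≐-trans (d j) (d′ j)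
      }
    }

  infixl 6 _⊞_
  _⊞_ : Tower → Tower → Tower
  f ⊞ f′ = record
    { at      = λ i g → at f i g + at f′ i g
    ; at-cong = λ i e → +-cong (at-cong f i e) (at-cong f′ i e)
    ; at-p    = λ i g → trans (×-distrib-+ _ _ p) (+-cong (at-p f i g) (at-p f′ i g))
    }

  ⊞-cong : ∀ {i f f′ k k′} → f ≈[ i ] f′ → k ≈[ i ] k′ → f ⊞ k ≈[ i ] f′ ⊞ k′
  ⊞-cong (e & d) (e′ & d′) = (λ g → +-cong (e g) (e′ g)) & λ j → ≐-+ (d j) (d′ j)

  mapTower : ModuleHom A A → Tower → Tower
  mapTower φ f = record
    { at      = λ i g → ⟦ at f i g ⟧
    ; at-cong = λ i e → ⟦⟧-cong (at-cong f i e)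
    ; at-p    = λ i g → trans (sym (hom-× {M = A} {A} φ p _)) (⟦⟧-cong (at-p f i g))
    }
    where open ModuleHom φ

  mapTower-cong : ∀ φ {i f f′} → f ≈[ i ] f′ → mapTower φ f ≈[ i ] mapTower φ f′
  mapTower-cong φ (e & d) = (λ g → ⟦⟧-cong (e g)) & λ j → ≐-map φ (d j)
    where open ModuleHom φ

  zeroTower : Tower
  zeroTower = record
    { at      = λ _ _ → 0#
    ; at-cong = λ _ _ → A.refl
    ; at-p    = λ _ _ → ×-zero 0 A p
    }

  act : G.Carrier → Tower → Tower
  act g f = record
    { at      = λ i h → at f i (h G.∙ g)
    ; at-cong = λ i e → at-cong f i (G.∙-congʳ e)
    ; at-p    = λ i h → at-p f i (h G.∙ g)
    }

  act-cong : ∀ g {i f f′} → f ≈[ i ] f′ → act g f ≈[ i ] act g f′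
  act-cong g (e & d) = (λ h → e (h G.∙ g)) & λ j → ≐-act g (d j)

  shift : Tower → Tower
  shift f = record
    { at      = λ i → at f (suc i)
    ; at-cong = λ i → at-cong f (suc i)
    ; at-p    = λ i → at-p f (suc i)
    }

  -- Level 0 alone would make the action continuous; all levels are needed for shift to
  -- preserve smoothness.
  Smooth : Tower → Set (lsuc ℓ)
  Smooth f = ∀ i → LocallyConstant G.topology (towers i) (λ g → act g f)

  smooth-⊞ : ∀ {f f′} → Smooth f → Smooth f′ → Smooth (f ⊞ f′)
  smooth-⊞ s s′ i g =
    let U , oU , Ug , c  = s i g
        V , oV , Vg , c′ = s′ i g
    in (λ x → U x × V x) , G.open-∩ oU oV , (Ug , Vg) ,
       λ x (Ux , Vx) → ⊞-cong (c x Ux) (c′ x Vx)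

  smooth-map : ∀ φ {f} → Smooth f → Smooth (mapTower φ f)
  smooth-map φ s i g =
    let U , oU , Ug , c = s i g in U , oU , Ug , λ x Ux → mapTower-cong φ (c x Ux)

  smooth-zero : Smooth zeroTower
  smooth-zero i g = (λ _ → ⊤) , G.open-univ , tt , λ _ _ → Setoid.refl (towers i)

  smooth-shift : ∀ {f} → Smooth f → Smooth (shift f)
  smooth-shift s i g =
    let U , oU , Ug , c = s (suc i) g
    in U , oU , Ug , λ x Ux → equal (c x Ux) & λ j → congruent (c x Ux) (suc j)

  smooth-act : ∀ k {f} → Smooth f → Smooth (act k f)
  smooth-act k {f} s i g =
    let U , oU , Ug , c = s i (g G.∙ k)
    in (λ x → U (x G.∙ k)) , translateʳ-open G k oU , Ug , λ x Ux →
       Setoid.trans (towers i) (reassoc x)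
         (Setoid.trans (towers i) (c (x G.∙ k) Ux) (Setoid.sym (towers i) (reassoc g)))
    where
    reassoc : ∀ x → act x (act k f) ≈[ i ] act (x G.∙ k) f
    reassoc x = pointwise-≈ (λ j h → at-cong f j (G.assoc h x k)) i

  negation : ModuleHom A A
  negation = record
    { ⟦_⟧ = -_
    ; isGroupHomomorphism = record
      { isMonoidHomomorphism = record
        { isMagmaHomomorphism = record
          { isRelHomomorphism = record { cong = A.-‿cong }
          ; homo              = λ x y → sym (⁻¹-∙-comm x y)
          }
        ; ε-homo = ε⁻¹≈ε
        }
      ; ⁻¹-homo = λ _ → A.refl
      }
    ; equivariant = λ g x → sym (A.·-neg g x)
    }

  -- Smooth f is too large for a component of a module at level ℓ; excluded middle makes
  -- it equivalent to a small type.
  SmoothTower : Set ℓ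
  SmoothTower = Σ Tower λ f → True (em {Smooth f})

  smooth : (f : Tower) → Smooth f → SmoothTower
  smooth f s = f , fromWitness s

  isSmooth : (f : SmoothTower) → Smooth (proj₁ f)
  isSmooth f = toWitness (proj₂ f)

  towerModule : DiscreteModule G ℓ
  towerModule = record
    { abelianGroup = record
      { Carrier = SmoothTower
      ; _≈_     = λ f f′ → proj₁ f ≈[ 0 ] proj₁ f′
      ; _∙_     = λ f f′ → smooth (proj₁ f ⊞ proj₁ f′) (smooth-⊞ {proj₁ f} {proj₁ f′} (isSmooth f) (isSmooth f′))
      ; ε       = smooth zeroTower smooth-zero
      ; _⁻¹     = λ f → smooth (mapTower negation (proj₁ f)) (smooth-map negation {proj₁ f} (isSmooth f))
      ; isAbelianGroup = record
        { isGroup = record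
          { isMonoid = record
            { isSemigroup = record
              { isMagma = record
                { isEquivalence = record
                  { refl  = Setoid.refl (towers 0)
                  ; sym   = Setoid.sym (towers 0)
                  ; trans = Setoid.trans (towers 0)
                  }
                ; ∙-cong = ⊞-cong
                }
              ; assoc = λ f g h → pw (λ _ _ → A.+-assoc _ _ _)
              }
            ; identity = (λ f → pw (λ _ _ → A.+-identityˡ _)) , (λ f → pw (λ _ _ → A.+-identityʳ _))
            }
          ; inverse = (λ f → pw (λ _ _ → A.-‿inverseˡ _)) , (λ f → pw (λ _ _ → A.-‿inverseʳ _))
          ; ⁻¹-cong = mapTower-cong negation
          }
        ; comm = λ f g → pw (λ _ _ → A.+-comm _ _)
        }
      }
    ; _·_          = λ g f → smooth (act g (proj₁ f)) (smooth-act g {proj₁ f} (isSmooth f))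
    ; ·-cong       = λ {g} {h} {f} {f′} g≈h f≈f′ → Setoid.trans (towers 0) (act-cong g f≈f′)
        (pw (λ j k → at-cong (proj₁ f′) j (G.∙-congˡ g≈h)))
    ; ·-identity   = λ f → pw (λ j k → at-cong (proj₁ f) j (G.identityʳ k))
    ; ·-assoc      = λ g h f → pw (λ j k → at-cong (proj₁ f) j (G.sym (G.assoc k g h)))
    ; ·-distrib-+  = λ g f f′ → pw (λ _ _ → A.refl)
    ; ·-continuous = λ f → isSmooth f 0
    }
    where
    pw : ∀ {f f′} → (∀ j g → at f j g ≈ at f′ j g) → f ≈[ 0 ] f′
    pw e = pointwise-≈ e 0

  private module M = DiscreteModule towerModule
  open Mult M.commutativeMonoid using () renaming (_×_ to infixl 7 _×ₘ_)

  at-× : ∀ k f i g → at (proj₁ (k ×ₘ f)) i g ≡ k ×ₐ at (proj₁ f) i g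
  at-× zero    f i g = ≡.refl
  at-× (suc k) f i g = cong (λ x → at (proj₁ f) i g + x) (at-× k f i g)

  -- The shift is division by p, because p times level j + 1 is level j.
  towerModule-p-divisible : Divisible towerModule p
  towerModule-p-divisible f = y , pointwise-≈ (λ j g → begin
      at (proj₁ (p ×ₘ y)) j g         ≡⟨ at-× p y j g ⟩
      p ×ₐ at (proj₁ f) (suc j) g     ≈⟨ at-p (proj₁ f) j g ⟩
      at (proj₁ f) j g                ∎) 0
    where y = smooth (shift (proj₁ f)) (smooth-shift {proj₁ f} (isSmooth f))

  at-p^ : ∀ f v j g → (p ℕ.^ v) ×ₐ at f (v ℕ.+ j) g ≈ at f j g
  at-p^ f zero    j g = ×-homo-1 _
  at-p^ f (suc v) j g = begin
    (p ℕ.* p ℕ.^ v) ×ₐ at f (suc v ℕ.+ j) g   ≈⟨ ×-congˡ (ℕP.*-comm p (p ℕ.^ v)) ⟩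
    (p ℕ.^ v ℕ.* p) ×ₐ at f (suc v ℕ.+ j) g   ≈⟨ ×-assocˡ _ (p ℕ.^ v) p ⟨
    (p ℕ.^ v) ×ₐ (p ×ₐ at f (suc v ℕ.+ j) g)  ≈⟨ ×-congʳ (p ℕ.^ v) (at-p f (v ℕ.+ j) g) ⟩
    (p ℕ.^ v) ×ₐ at f (v ℕ.+ j) g             ≈⟨ at-p^ f v j g ⟩
    at f j g                                  ∎

  -- Division by integers prime to p, and torsion

  module _ (b : ℕ) (b-divisible : Divisible A b) (b-torsionFree : TorsionFree A b) where

    b-injective : ∀ {x y} → b ×ₐ x ≈ b ×ₐ y → x ≈ y
    b-injective {x} {y} e = x∙y⁻¹≈ε⇒x≈y x y (b-torsionFree _ (begin
      b ×ₐ (x + - y)         ≈⟨ ×-distrib-+ x (- y) b ⟩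
      b ×ₐ x + b ×ₐ (- y)    ≈⟨ +-cong e (×-neg 0 A b y) ⟩
      b ×ₐ y + - (b ×ₐ y)    ≈⟨ A.-‿inverseʳ _ ⟩
      0#                     ∎))
      where open AbelianGroupProperties A.abelianGroup using (x∙y⁻¹≈ε⇒x≈y)

    -- Division by b has a unique result, so the chosen quotients automatically form an equivariant
    -- homomorphism, and this can be applied to a tower level by level.
    quotient : ModuleHom A A
    quotient = record
      { ⟦_⟧ = b⁻¹
      ; isGroupHomomorphism = record
        { isMonoidHomomorphism = record
          { isMagmaHomomorphism = record
            { isRelHomomorphism = record
              { cong = λ {x} {y} e → b-injective (trans (b-b⁻¹ x) (trans e (sym (b-b⁻¹ y)))) }
            ; homo = λ x y → b-injective (trans (b-b⁻¹ (x + y))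
                (sym (trans (×-distrib-+ _ _ b) (+-cong (b-b⁻¹ x) (b-b⁻¹ y)))))
            }
          ; ε-homo = b-injective (trans (b-b⁻¹ 0#) (sym (×-zero 0 A b)))
          }
        ; ⁻¹-homo = λ x → b-injective (trans (b-b⁻¹ (- x))
            (sym (trans (×-neg 0 A b _) (A.-‿cong (b-b⁻¹ x)))))
        }
      ; equivariant = λ g x → b-injective (trans (b-b⁻¹ (g · x))
          (sym (trans (×-· 0 A b g _) (·-cong G.refl (b-b⁻¹ x)))))
      }
      where
      b⁻¹ : A.Carrier → A.Carrier
      b⁻¹ x = proj₁ (b-divisible x)
      b-b⁻¹ : ∀ x → b ×ₐ b⁻¹ x ≈ x
      b-b⁻¹ x = proj₂ (b-divisible x)

    towerModule-b-divisible : Divisible towerModule b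
    towerModule-b-divisible f = y , pointwise-≈ (λ j g → begin
        at (proj₁ (b ×ₘ y)) j g     ≡⟨ at-× b y j g ⟩
        b ×ₐ at (proj₁ y) j g       ≈⟨ proj₂ (b-divisible _) ⟩
        at (proj₁ f) j g            ∎) 0
      where y = smooth (mapTower quotient (proj₁ f)) (smooth-map quotient {proj₁ f} (isSmooth f))

    -- Multiplication by pᵛ moves down v levels, so b times level j of f is level v + j of pᵛ b f.
    -- The latter has the form h ↦ h · s, and dividing s by b puts level j itself into A.
    torsion⇒≐0 : ∀ v f → (p ℕ.^ v ℕ.* b) ×ₘ f M.≈ M.0# → ∀ j → at (proj₁ f) j ≐ (λ _ → 0#)
    torsion⇒≐0 v f (_ & e) j =
      let s , d = e (v ℕ.+ j)
          open ModuleHom quotient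
      in ≈·⇒≐0 ⟦ s ⟧ λ h → b-injective (begin
        b ×ₐ at (proj₁ f) j h                               ≈⟨ ×-congʳ b (at-p^ (proj₁ f) v j h) ⟨
        b ×ₐ ((p ℕ.^ v) ×ₐ at (proj₁ f) (v ℕ.+ j) h)        ≈⟨ ×-assocˡ _ b (p ℕ.^ v) ⟩
        (b ℕ.* p ℕ.^ v) ×ₐ at (proj₁ f) (v ℕ.+ j) h         ≈⟨ ×-congˡ (ℕP.*-comm b (p ℕ.^ v)) ⟩
        (p ℕ.^ v ℕ.* b) ×ₐ at (proj₁ f) (v ℕ.+ j) h         ≡⟨ at-× (p ℕ.^ v ℕ.* b) f (v ℕ.+ j) h ⟨
        at (proj₁ ((p ℕ.^ v ℕ.* b) ×ₘ f)) (v ℕ.+ j) h       ≈⟨ d h ⟩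
        0# + h · s                                          ≈⟨ A.+-identityˡ _ ⟩
        h · s                                               ≈⟨ ·-cong G.refl (proj₂ (b-divisible s)) ⟨
        h · (b ×ₐ ⟦ s ⟧)                                    ≈⟨ ×-· 0 A b h ⟦ s ⟧ ⟨
        b ×ₐ (h · ⟦ s ⟧)                                    ∎)

  pPower-torsion⇒≐0 : ∀ v f → (p ℕ.^ v) ×ₘ f M.≈ M.0# → ∀ j → at (proj₁ f) j ≐ (λ _ → 0#)
  pPower-torsion⇒≐0 v f e = torsion⇒≐0 1 (λ x → x , ×-homo-1 x) (λ x e → trans (sym (×-homo-1 x)) e) v f
    (Setoid.trans (towers 0) (Mult.×-congˡ M.commutativeMonoid {f} (ℕP.*-identityʳ (p ℕ.^ v))) e)

  module _ (p-divisible : Divisible A p) (p-primary : ∀ x → IsPrimaryTorsion p A x) where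

    roots : A.Carrier → ℕ → A.Carrier
    roots s zero    = s
    roots s (suc i) = proj₁ (p-divisible (roots s i))

    -- A lift of s along the projection lim A → A. Another choice of roots changes it by an element
    -- of Tₚ(A), so its class is determined by s.
    linearTower : A.Carrier → Tower
    linearTower s = record
      { at      = λ i g → g · roots s i
      ; at-cong = λ i e → ·-cong e A.refl
      ; at-p    = λ i g → trans (×-· 0 A p g _) (·-cong G.refl (proj₂ (p-divisible (roots s i))))
      }

    -- Translation by x replaces `roots s i` by `x · roots s i`, so level i is locally constant
    -- because the action on A is; all levels stay in A and are thus congruent.
    linearTower-smooth : ∀ s → Smooth (linearTower s)
    linearTower-smooth s i g =
      let U , oU , Ug , c = A.·-continuous (roots s i) g
      in U , oU , Ug , λ x Ux →
         (λ h → trans (A.·-assoc h x _) (trans (·-cong G.refl (c x Ux)) (sym (A.·-assoc h g _)))) &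
         λ j → ≐-trans (≈·⇒≐0 (x · roots s j) (λ h → A.·-assoc h x _))
                 (≐-sym (≈·⇒≐0 (g · roots s j) (λ h → A.·-assoc h g _)))

    -- All levels of a p-primary element lie in A. Hence level 0 is determined by its value at the
    -- identity, and congruence at the other levels is automatic. The inverse sends s to its tower
    -- of p-th roots.
    towerModule-torsion : ModuleIso (primaryTorsion p towerModule) A
    towerModule-torsion = record
      { ⟦_⟧ = λ (f , _) → at (proj₁ f) 0 G.ε
      ; isGroupIsomorphism = record
        { isGroupMonomorphism = record
          { isGroupHomomorphism = record
            { isMonoidHomomorphism = record
              { isMagmaHomomorphism = record
                { isRelHomomorphism = record { cong = λ (e & _) → e G.ε }
                ; homo              = λ _ _ → A.refl
                }
              ; ε-homo = A.refl
              }
            ; ⁻¹-homo = λ _ → A.refl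
            }
          ; injective = λ {x} {y} e →
              (λ g → trans (linear x g) (trans (·-cong G.refl e) (sym (linear y g)))) &
              λ j → ≐-trans (≐0 x j) (≐-sym (≐0 y j))
          }
        ; surjective = λ s → preimage s , λ (e & _) → trans (e G.ε) (A.·-identity s)
        }
      ; equivariant = λ g x → trans (at-cong (proj₁ (proj₁ x)) 0 (G.identityˡ g)) (linear x g)
      }
      where
      ≐0 : ∀ (x : DiscreteModule.Carrier (primaryTorsion p towerModule)) j →
           at (proj₁ (proj₁ x)) j ≐ (λ _ → 0#)
      ≐0 (f , n , e) = pPower-torsion⇒≐0 n f e
      linear : ∀ (x : DiscreteModule.Carrier (primaryTorsion p towerModule)) g →
               at (proj₁ (proj₁ x)) 0 g ≈ g · at (proj₁ (proj₁ x)) 0 G.ε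
      linear x = ≐0⇒≈· (≐0 x 0)
      preimage : A.Carrier → DiscreteModule.Carrier (primaryTorsion p towerModule)
      preimage s =
        let n , pⁿs≈0 = p-primary s
            f = smooth (linearTower s) (linearTower-smooth s)
            scaled : ∀ j g → at (proj₁ ((p ℕ.^ n) ×ₘ f)) j g ≈ g · ((p ℕ.^ n) ×ₐ roots s j)
            scaled j g = trans (A.reflexive (at-× (p ℕ.^ n) f j g)) (×-· 0 A (p ℕ.^ n) g _)
        in f , n ,
           (λ g → trans (scaled 0 g) (trans (·-cong G.refl pⁿs≈0) (A.·-zero g))) &
           λ j → ≈·⇒≐0 _ (scaled j)

-- Vanishing of the cohomology of towers

module Vanishing {ℓ} (em : ExcludedMiddle (lsuc ℓ)) {p : ℕ} (p-prime : Prime p)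
  {G : TopologicalGroup ℓ} (compact : TopologicalGroup.Compact G) (A : DiscreteModule G 0ℓ)
  (p-divisible    : Divisible A p)
  (p′-divisible   : ∀ b → p ∤ b → Divisible A b)
  (p′-torsionFree : ∀ b → p ∤ b → TorsionFree A b)
  (H¹-divisible   : ∀ H → H¹-Divisible (restrict H A) p)
  where
  private module G = TopologicalGroup G
  open DiscreteModule A
  open Mult commutativeMonoid using (×-distrib-+) renaming (_×_ to infixl 7 _×ₐ_)
  open TowerModule em p A
  open Tower
  open _≈[_]_
  private module M = DiscreteModule towerModule
  open Mult M.commutativeMonoid using () renaming (_×_ to infixl 7 _×ₘ_)

  towerModule-divisible : ∀ N .{{_ : ℕ.NonZero N}} → Divisible towerModule N
  towerModule-divisible N with p-part p-prime N (<-wellFounded N)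
  ... | v , b , _ , p∤b , ≡.refl =
    *-divisible towerModule (p ℕ.^ v) b (^-divisible towerModule p towerModule-p-divisible v)
      (towerModule-b-divisible b (p′-divisible b p∤b) (p′-torsionFree b p∤b))

  towerModule-torsion⇒≐0 : ∀ N .{{_ : ℕ.NonZero N}} f → N ×ₘ f M.≈ M.0# →
                           ∀ j → at (proj₁ f) j ≐ (λ _ → 0#)
  towerModule-torsion⇒≐0 N f e with p-part p-prime N (<-wellFounded N)
  ... | v , b , _ , p∤b , ≡.refl =
    torsion⇒≐0 b (p′-divisible b p∤b) (p′-torsionFree b p∤b) v f e

  module _ (H : OpenSubgroup G) where
    private
      module H = TopologicalGroup (asTopologicalGroup H)
    open OpenSubgroup H
    Aₕ = restrict H A
    Mₕ = restrict H towerModule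

    open Cocycle

    -- As A is p-divisible, the coboundary can be absorbed: every cocycle, and not only its
    -- class, is divisible by p.
    divide : (α : Cocycle Aₕ) → Σ (Cocycle Aₕ) λ β → ∀ g → p ×ₐ ⟦ β ⟧ g ≈ ⟦ α ⟧ g
    divide α =
      let β , y , pβ≈α+∂y = H¹-divisible H α
          z , pz≈y = p-divisible y
      in _⊕_ Aₕ β (⊖_ Aₕ (coboundary Aₕ z)) , λ g → begin
        p ×ₐ (⟦ β ⟧ g + - ∂ Aₕ z g)           ≈⟨ ×-distrib-+ _ _ p ⟩
        p ×ₐ ⟦ β ⟧ g + p ×ₐ (- ∂ Aₕ z g)      ≈⟨ +-cong (pβ≈α+∂y g) (×-neg 0 A p _) ⟩
        ⟦ α ⟧ g + ∂ Aₕ y g + - (p ×ₐ ∂ Aₕ z g) ≈⟨ +-congˡ (-‿cong (hom-∂ {M = Aₕ} {Aₕ} (scale Aₕ p) z g)) ⟩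
        ⟦ α ⟧ g + ∂ Aₕ y g + - ∂ Aₕ (p ×ₐ z) g ≈⟨ +-congˡ (-‿cong (∂-cong Aₕ pz≈y g)) ⟩
        ⟦ α ⟧ g + ∂ Aₕ y g + - ∂ Aₕ y g        ≈⟨ +-assoc _ _ _ ⟩
        ⟦ α ⟧ g + (∂ Aₕ y g + - ∂ Aₕ y g)      ≈⟨ +-congˡ (-‿inverseʳ _) ⟩
        ⟦ α ⟧ g + 0#                          ≈⟨ +-identityʳ _ ⟩
        ⟦ α ⟧ g                               ∎
      where open SetoidReasoning setoid

    -- The projection onto the left cosets is locally constant, so compactness makes them finite in
    -- number; the enumeration then supplies one representative for each coset.
    cosets : Values (leftCosets G H) {X = G.Carrier} id
    cosets =
      let xs , cov = finitelyManyValues em compact (whole G) (leftCosets G H) {proj₁} λ (x , _) →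
            _ , (_ , leftCoset-open G H x , λ _ → mk⇔ id id) , Setoid.refl (leftCosets G H) ,
            λ y → Setoid.sym (leftCosets G H)
      in values (leftCosets G H) (λ _ _ → em↓ em) id (map proj₁ xs) (λ y → AnyP.map⁺ (cov (y , tt)))

    open Values cosets

    -- Each cocycle on H is the coboundary of a function on G; as the coset representatives
    -- do not depend on the cocycle, successive p-th roots of α yield a tower.
    module _ (α : Cocycle Aₕ) where

      root : ℕ → Cocycle Aₕ
      root zero    = α
      root (suc i) = proj₁ (divide (root i))

      -- The index and the membership proof are separate arguments so that `extend-cong` can
      -- identify two indices while leaving the two proofs arbitrary.
      extend : Cocycle Aₕ → ∀ x i → member (rep i G.⁻¹ G.∙ x) → Carrier
      extend β x i m = rep i · ⟦ β ⟧ (rep i G.⁻¹ G.∙ x , m)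

      extend-cong : ∀ β {x y i j} m m′ → x G.≈ y → i ≡ j → extend β x i m ≈ extend β y j m′
      extend-cong β m m′ x≈y ≡.refl = ·-cong G.refl (⟦⟧-cong β (G.∙-congˡ x≈y))

      extended : Cocycle Aₕ → G.Carrier → Carrier
      extended β x = extend β x (idx x) (f-rep x)

      extended-cong : ∀ β {x y} → x G.≈ y → extended β x ≈ extended β y
      extended-cong β {x} {y} x≈y = extend-cong β (f-rep x) (f-rep y) x≈y
        (idx-cong (G.open-resp-≈ isOpen (G.∙-congˡ x≈y) (Setoid.refl (leftCosets G H) {x})))

      -- The points x and x ∙ g lie in one left coset and share its representative r. The cocycle
      -- identity for r⁻¹x and g then contributes r · (r⁻¹x · β(g)) = x · β(g). Thus translating by
      -- g and subtracting leaves the image of β(g) in the functions on G.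
      extended-∙ : ∀ β x g → extended β (x G.∙ proj₁ g) ≈ extended β x + x · ⟦ β ⟧ g
      extended-∙ β x g@(g′ , Hg) = begin
        extended β (x G.∙ g′)
          ≈⟨ extend-cong β _ (G.open-resp-≈ isOpen (G.assoc _ _ _) (∙-closed (f-rep x) Hg)) G.refl
               (idx-cong (Setoid.sym (leftCosets G H) (G.open-resp-≈ isOpen (G.sym (\\-leftDividesʳ x g′)) Hg))) ⟩
        rep (idx x) · ⟦ β ⟧ (rep (idx x) G.⁻¹ G.∙ (x G.∙ g′) , _)
          ≈⟨ ·-cong G.refl (⟦⟧-cong β (G.sym (G.assoc _ _ _))) ⟩
        rep (idx x) · ⟦ β ⟧ ((rep (idx x) G.⁻¹ G.∙ x , f-rep x) H.∙ g)
          ≈⟨ ·-cong G.refl (cocycle β _ g) ⟩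
        rep (idx x) · (⟦ β ⟧ (rep (idx x) G.⁻¹ G.∙ x , f-rep x) + (rep (idx x) G.⁻¹ G.∙ x) · ⟦ β ⟧ g)
          ≈⟨ ·-distrib-+ _ _ _ ⟩
        extended β x + rep (idx x) · ((rep (idx x) G.⁻¹ G.∙ x) · ⟦ β ⟧ g)
          ≈⟨ +-congˡ (trans (sym (·-assoc _ _ _)) (·-cong (\\-leftDividesˡ _ x) (Setoid.refl setoid))) ⟩
        extended β x + x · ⟦ β ⟧ g ∎
        where
        open SetoidReasoning setoid
        open GroupProperties G.group using (\\-leftDividesˡ; \\-leftDividesʳ)

      integral : Tower
      integral = record
        { at      = λ i → extended (root i)
        ; at-cong = λ i → extended-cong (root i)
        ; at-p    = λ i x → trans (×-· 0 A p _ _) (·-cong G.refl (proj₂ (divide (root i)) _))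
        }

      integral-∙ : ∀ j g h u → h G.⁻¹ G.∙ g G.≈ proj₁ u → ∀ x →
        at integral j (x G.∙ g) ≈ at integral j (x G.∙ h) + x · (h · ⟦ root j ⟧ u)
      integral-∙ j g h u h⁻¹g≈u x = begin
        at integral j (x G.∙ g)
          ≈⟨ at-cong integral j (G.trans (G.∙-congˡ (G.sym (G.trans (G.∙-congˡ (G.sym h⁻¹g≈u)) (\\-leftDividesˡ h g)))) (G.sym (G.assoc x h _))) ⟩
        at integral j (x G.∙ h G.∙ proj₁ u)
          ≈⟨ extended-∙ (root j) (x G.∙ h) u ⟩
        at integral j (x G.∙ h) + (x G.∙ h) · ⟦ root j ⟧ u
          ≈⟨ +-congˡ (·-assoc x h _) ⟩
        at integral j (x G.∙ h) + x · (h · ⟦ root j ⟧ u) ∎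
        where
        open SetoidReasoning setoid
        open GroupProperties G.group using (\\-leftDividesˡ)

      -- Near h write g = h ∙ u with u in H so close to the identity that the i-th root of α
      -- vanishes at u. Then level i does not change, and each level j changes by x ↦ x · (h ·
      -- β_j(u)), where β_j is the j-th root, that is, by an element of A.
      integral-smooth : Smooth integral
      integral-smooth i h =
        let W , (V , oV , W⇔V) , Wε , const = continuous (root i) H.ε
            resp = G.open-resp-≈
        in (λ g → V (h G.⁻¹ G.∙ g) × member (h G.⁻¹ G.∙ g)) ,
           translateˡ-open G (h G.⁻¹) (G.open-∩ oV isOpen) ,
           (resp oV (G.sym (G.inverseˡ h)) (Equivalence.to (W⇔V H.ε) Wε) ,
            resp isOpen (G.sym (G.inverseˡ h)) ε-closed) ,
           λ g (Vu , Hu) →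
             let u = h G.⁻¹ G.∙ g , Hu
                 αu≈0 : ⟦ root i ⟧ u ≈ 0#
                 αu≈0 = trans (const u (Equivalence.from (W⇔V u) Vu)) (⟦ε⟧≈0 Aₕ (root i))
             in (λ x → trans (integral-∙ i g h u G.refl x)
                   (trans (+-congˡ (trans (·-cong G.refl (trans (·-cong G.refl αu≈0) (·-zero h))) (·-zero x)))
                     (+-identityʳ _))) &
                λ j → h · ⟦ root j ⟧ u , integral-∙ j g h u G.refl

      ∂-integral : ∀ g x → at (act (proj₁ g) integral) 0 x + - at integral 0 x ≈ x · ⟦ α ⟧ g
      ∂-integral g x = trans (+-congʳ (extended-∙ α x g)) (xyx⁻¹≈y _ _)
        where open AbelianGroupProperties abelianGroup using (xyx⁻¹≈y)

      ∂-integral-≐0 : ∀ g j → (λ x → at (act (proj₁ g) integral) j x + - at integral j x) ≐ (λ _ → 0#)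
      ∂-integral-≐0 g j = ≈·⇒≐0 (⟦ root j ⟧ g) λ x →
        trans (+-congʳ (extended-∙ (root j) x g)) (xyx⁻¹≈y _ _)
        where open AbelianGroupProperties abelianGroup using (xyx⁻¹≈y)

    -- The values of c come from A, so level 0 at the identity yields a cocycle α of A. The
    -- coboundary of `integral α` agrees with c at level 0, while at every level both lie in A; this
    -- is equality modulo Tₚ(A).
    torsion-trivial : (c : Cocycle Mₕ) → (∀ g j → at (proj₁ (⟦ c ⟧ g)) j ≐ (λ _ → 0#)) →
                      ∃[ f ] ∀ g → ⟦ c ⟧ g M.≈ ∂ Mₕ f g
    torsion-trivial c c≐0 = smooth (integral α) (integral-smooth α) , λ g →
      (λ x → trans (linear g x) (sym (∂-integral α g x))) &
      λ j → ≐-trans (c≐0 g j) (≐-sym (∂-integral-≐0 α g j))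
      where
      c₀ : H.Carrier → G.Carrier → Carrier
      c₀ g = at (proj₁ (⟦ c ⟧ g)) 0
      linear : ∀ g x → c₀ g x ≈ x · c₀ g G.ε
      linear g = ≐0⇒≈· (c≐0 g 0)
      α : Cocycle Aₕ
      α = record
        { ⟦_⟧        = λ g → c₀ g G.ε
        ; ⟦⟧-cong    = λ e → equal (⟦⟧-cong c e) G.ε
        ; continuous = λ g →
            let U , oU , Ug , const = continuous c g
            in U , oU , Ug , λ h Uh → equal (const h Uh) G.ε
        ; cocycle    = λ g h → trans (equal (cocycle c g h) G.ε)
            (+-congˡ (trans (linear h _) (·-cong (G.identityˡ (proj₁ g)) (Setoid.refl setoid))))
        }

    towerModule-H¹-trivial : IsTrivial (H¹ Mₕ)
    towerModule-H¹-trivial c = reduction-to-torsion Mₕ c vs (towerModule-divisible N {{N≢0}})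
      λ c′ Nc′≈0 → torsion-trivial c′ λ g → towerModule-torsion⇒≐0 N {{N≢0}} (⟦ c′ ⟧ g) (Nc′≈0 g)
      where
      vs : Values M.setoid (⟦ c ⟧)
      vs = let xs , cov = finitelyManyValues em compact H M.setoid {⟦ c ⟧} (continuous c)
           in values M.setoid (λ _ _ → em↓ em) (⟦ c ⟧) xs cov
      N = Values.size vs
      N≢0 : ℕ.NonZero N
      -- The index of the value at the identity is an element of `Fin N`, which rules out N = 0.
      N≢0 with N | Values.idx vs H.ε
      ... | suc _ | _ = _

-- Kummer theory

module _ {ℓ m} {G : TopologicalGroup ℓ} (p : ℕ) (M : DiscreteModule G m) where
  open DiscreteModule M

  torsionInclusion : ModuleHom (primaryTorsion p M) M
  torsionInclusion = record
    { ⟦_⟧ = proj₁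
    ; isGroupHomomorphism = record
      { isMonoidHomomorphism = record
        { isMagmaHomomorphism = record
          { isRelHomomorphism = record { cong = id }
          ; homo              = λ _ _ → Setoid.refl setoid
          }
        ; ε-homo = Setoid.refl setoid
        }
      ; ⁻¹-homo = λ _ → Setoid.refl setoid
      }
    ; equivariant = λ _ _ → Setoid.refl setoid
    }

-- T n plays the role of ℤ/pⁿℤ(1), which J n identifies with A[pⁿ].
record KummerTower {ℓ} (p : ℕ) {G : TopologicalGroup ℓ} (A : DiscreteModule G 0ℓ) : Set (lsuc ℓ) where
  private module A = DiscreteModule A
  open Mult A.commutativeMonoid using () renaming (_×_ to infixl 7 _×ₐ_)
  field
    T   : ℕ → DiscreteModule G 0ℓ
    J   : ∀ n → ModuleHom (T n) A
    red : ∀ n → ModuleHom (T (suc n)) (T 1)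
  module T n = DiscreteModule (T n)
  module J n = ModuleHom (J n)
  module red n = ModuleHom (red n)
  field
    J-killed    : ∀ x → p ×ₐ J.⟦_⟧ 1 x A.≈ A.0#
    J-injective : ∀ n {x y} → J.⟦_⟧ n x A.≈ J.⟦_⟧ n y → T._≈_ n x y
    J-onto      : ∀ n s → (p ℕ.^ n) ×ₐ s A.≈ A.0# → ∃[ x ] J.⟦_⟧ n x A.≈ s
    -- This compatibility is what turns lifting of cocycles along the reduction into division by
    -- powers of p in A.
    J-red       : ∀ n x → (p ℕ.^ n) ×ₐ J.⟦_⟧ (suc n) x A.≈ J.⟦_⟧ 1 (red.⟦_⟧ n x)

module Kummer {ℓ} {p : ℕ} {G : TopologicalGroup ℓ} {A : DiscreteModule G 0ℓ}
              (K : KummerTower p A) where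
  private module A = DiscreteModule A
  open KummerTower K
  open Mult A.commutativeMonoid
    using (×-congʳ; ×-congˡ; ×-assocˡ; ×-distrib-+; ×-homo-1) renaming (_×_ to infixl 7 _×ₐ_)
  open Cocycle

  module _ (H : OpenSubgroup G) where
    Aₕ = restrict H A
    Tₕ = λ n → restrict H (T n)
    Jₕ = λ n → restrictHom H {T n} {A} (J n)

    reduce : ∀ n → Cocycle (Tₕ (suc n)) → Cocycle (Tₕ 1)
    reduce n = H¹-map {M = Tₕ (suc n)} {Tₕ 1} (restrictHom H {T (suc n)} {T 1} (red n))

    Lifts : ℕ → Set (lsuc ℓ)
    Lifts n = Surjective (_~_ (Tₕ (suc n))) (_~_ (Tₕ 1)) (reduce n)

    module _ (lifts : ∀ n → Lifts n) (p-divisible : Divisible A p) where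
      open A using (_≈_; _+_; -_; _·_; 0#; +-cong; +-congˡ; +-congʳ; ·-cong; sym; trans)
      open SetoidReasoning A.setoid

      -- If pⁿ⁺¹ kills α, then pⁿ α lifts modulo pⁿ⁺² up to a coboundary, and subtracting p
      -- times the lift from α leaves a cocycle killed by pⁿ.
      torsion-divisible : ∀ n (α : Cocycle Aₕ) → (∀ g → (p ℕ.^ n) ×ₐ ⟦ α ⟧ g ≈ 0#) →
        Σ (Cocycle Aₕ) λ β → ∃[ y ] ∀ g → p ×ₐ ⟦ β ⟧ g ≈ ⟦ α ⟧ g + ∂ Aₕ y g
      torsion-divisible zero α α≈0 = 𝟎 Aₕ , 0# , λ g → begin
        p ×ₐ 0#                 ≈⟨ ×-zero 0 A p ⟩
        0#                      ≈⟨ A.+-identityˡ 0# ⟨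
        0# + 0#                 ≈⟨ +-cong (trans (sym (α≈0 g)) (×-homo-1 _)) (sym (∂-0 Aₕ g)) ⟩
        ⟦ α ⟧ g + ∂ Aₕ 0# g     ∎
      torsion-divisible (suc n) α pα≈0 = _⊕_ Aₕ β γ , z + y , λ g → begin
        p ×ₐ (⟦ β ⟧ g + ⟦ γ ⟧ g)
          ≈⟨ ×-distrib-+ _ _ p ⟩
        p ×ₐ ⟦ β ⟧ g + p ×ₐ ⟦ γ ⟧ g
          ≈⟨ +-congʳ (proj₂ (proj₂ IH) g) ⟩
        ⟦ α ⟧ g + ∂ Aₕ z g + - (p ×ₐ ⟦ γ ⟧ g) + ∂ Aₕ y g + p ×ₐ ⟦ γ ⟧ g
          ≈⟨ trans (A.+-assoc _ _ _) (trans (+-congˡ (A.+-comm _ _)) (sym (A.+-assoc _ _ _))) ⟩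
        ⟦ α ⟧ g + ∂ Aₕ z g + - (p ×ₐ ⟦ γ ⟧ g) + p ×ₐ ⟦ γ ⟧ g + ∂ Aₕ y g
          ≈⟨ +-congʳ (//-rightDividesˡ (p ×ₐ ⟦ γ ⟧ g) _) ⟩
        ⟦ α ⟧ g + ∂ Aₕ z g + ∂ Aₕ y g
          ≈⟨ A.+-assoc _ _ _ ⟩
        ⟦ α ⟧ g + (∂ Aₕ z g + ∂ Aₕ y g)
          ≈⟨ +-congˡ (∂-+ Aₕ z y g) ⟨
        ⟦ α ⟧ g + ∂ Aₕ (z + y) g ∎
        where
        open AbelianGroupProperties A.abelianGroup using (//-rightDividesˡ)

        onto : ∀ g → ∃[ x ] J.⟦_⟧ 1 x ≈ (p ℕ.^ n) ×ₐ ⟦ α ⟧ g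
        onto g = J-onto 1 _ (begin
          (p ℕ.^ 1) ×ₐ ((p ℕ.^ n) ×ₐ ⟦ α ⟧ g)   ≈⟨ ×-assocˡ _ (p ℕ.^ 1) (p ℕ.^ n) ⟩
          (p ℕ.^ 1 ℕ.* p ℕ.^ n) ×ₐ ⟦ α ⟧ g      ≈⟨ ×-congˡ (cong (ℕ._* p ℕ.^ n) (ℕP.^-identityʳ p)) ⟩
          (p ℕ.^ suc n) ×ₐ ⟦ α ⟧ g              ≈⟨ pα≈0 g ⟩
          0#                                    ∎)

        a : Cocycle (Tₕ 1)
        a = lift-cocycle {M = Tₕ 1} {Aₕ} (Jₕ 1) (J-injective 1)
              (H¹-map {M = Aₕ} {Aₕ} (scale Aₕ (p ℕ.^ n)) α) (proj₁ ∘ onto) (proj₂ ∘ onto)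

        a′ : Cocycle (Tₕ (suc (suc n)))
        a′ = proj₁ (lifts (suc n) a)
        a′~a : _~_ (Tₕ 1) (reduce (suc n) a′) a
        a′~a = proj₂ (lifts (suc n) a) {a′} (AbelianGroup.refl (H¹ (Tₕ (suc (suc n)))) {a′})
        k = proj₁ a′~a

        -- The lift `a′` reduces to `a` only up to the coboundary of k. Choosing z with pⁿ z = J k
        -- moves this coboundary into α, so that pⁿ (α + ∂ z) and pⁿ p γ agree exactly.
        root : ∃[ z ] (p ℕ.^ n) ×ₐ z ≈ J.⟦_⟧ 1 k
        root = ^-divisible A p p-divisible n (J.⟦_⟧ 1 k)
        z = proj₁ root

        γ : Cocycle Aₕ
        γ = H¹-map {M = Tₕ (suc (suc n))} {Aₕ} (Jₕ (suc (suc n))) a′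

        α′ : Cocycle Aₕ
        α′ = _⊕_ Aₕ (_⊕_ Aₕ α (coboundary Aₕ z)) (⊖_ Aₕ (H¹-map {M = Aₕ} {Aₕ} (scale Aₕ p) γ))

        pⁿpγ : ∀ g → (p ℕ.^ n) ×ₐ (p ×ₐ ⟦ γ ⟧ g) ≈ (p ℕ.^ n) ×ₐ (⟦ α ⟧ g + ∂ Aₕ z g)
        pⁿpγ g = begin
          (p ℕ.^ n) ×ₐ (p ×ₐ ⟦ γ ⟧ g)                        ≈⟨ ×-assocˡ _ (p ℕ.^ n) p ⟩
          (p ℕ.^ n ℕ.* p) ×ₐ ⟦ γ ⟧ g                         ≈⟨ ×-congˡ (ℕP.*-comm (p ℕ.^ n) p) ⟩
          (p ℕ.^ suc n) ×ₐ ⟦ γ ⟧ g                           ≈⟨ J-red (suc n) (⟦ a′ ⟧ g) ⟩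
          J.⟦_⟧ 1 (red.⟦_⟧ (suc n) (⟦ a′ ⟧ g))               ≈⟨ J.⟦⟧-cong 1 (proj₂ a′~a g) ⟩
          J.⟦_⟧ 1 (T._+_ 1 (⟦ a ⟧ g) (∂ (Tₕ 1) k g))         ≈⟨ J.homo 1 _ _ ⟩
          J.⟦_⟧ 1 (⟦ a ⟧ g) + J.⟦_⟧ 1 (∂ (Tₕ 1) k g)         ≈⟨ +-cong (proj₂ (onto g)) (hom-∂ {M = Tₕ 1} {Aₕ} (Jₕ 1) k g) ⟩
          (p ℕ.^ n) ×ₐ ⟦ α ⟧ g + ∂ Aₕ (J.⟦_⟧ 1 k) g          ≈⟨ +-congˡ (∂-cong Aₕ (proj₂ root) g) ⟨
          (p ℕ.^ n) ×ₐ ⟦ α ⟧ g + ∂ Aₕ ((p ℕ.^ n) ×ₐ z) g     ≈⟨ +-congˡ (hom-∂ {M = Aₕ} {Aₕ} (scale Aₕ (p ℕ.^ n)) z g) ⟨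
          (p ℕ.^ n) ×ₐ ⟦ α ⟧ g + (p ℕ.^ n) ×ₐ ∂ Aₕ z g       ≈⟨ ×-distrib-+ _ _ (p ℕ.^ n) ⟨
          (p ℕ.^ n) ×ₐ (⟦ α ⟧ g + ∂ Aₕ z g)                  ∎

        IH : Σ (Cocycle Aₕ) λ β → ∃[ y ] ∀ g → p ×ₐ ⟦ β ⟧ g ≈ ⟦ α′ ⟧ g + ∂ Aₕ y g
        IH = torsion-divisible n α′ λ g → begin
          (p ℕ.^ n) ×ₐ (⟦ α ⟧ g + ∂ Aₕ z g + - (p ×ₐ ⟦ γ ⟧ g))
            ≈⟨ ×-distrib-+ _ _ (p ℕ.^ n) ⟩
          (p ℕ.^ n) ×ₐ (⟦ α ⟧ g + ∂ Aₕ z g) + (p ℕ.^ n) ×ₐ (- (p ×ₐ ⟦ γ ⟧ g))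
            ≈⟨ +-cong (sym (pⁿpγ g)) (×-neg 0 A (p ℕ.^ n) _) ⟩
          (p ℕ.^ n) ×ₐ (p ×ₐ ⟦ γ ⟧ g) + - ((p ℕ.^ n) ×ₐ (p ×ₐ ⟦ γ ⟧ g))
            ≈⟨ A.-‿inverseʳ _ ⟩
          0# ∎
        β = proj₁ IH
        y = proj₁ (proj₂ IH)

    module _ (em : ExcludedMiddle (lsuc ℓ)) (compact : TopologicalGroup.Compact G)
             (p-primary : ∀ x → IsPrimaryTorsion p A x) where
      open A using (_≈_; 0#)

      -- Compactness leaves only finitely many values, and the sum of their exponents serves for all
      -- of them.
      exponent : (α : Cocycle Aₕ) → ∃[ n ] ∀ g → (p ℕ.^ n) ×ₐ ⟦ α ⟧ g ≈ 0#
      exponent α =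
        let xs , cov = finitelyManyValues em compact H A.setoid {⟦ α ⟧} (continuous α)
            n , kills = common xs
        in n , λ g → kills g (cov g)
        where
        open SetoidReasoning A.setoid
        common : ∀ xs → ∃[ n ] ∀ y → Any (λ x → ⟦ α ⟧ x ≈ ⟦ α ⟧ y) xs → (p ℕ.^ n) ×ₐ ⟦ α ⟧ y ≈ 0#
        common []       = 0 , λ _ ()
        common (x ∷ xs) =
          let i , pⁱx≈0 = p-primary (⟦ α ⟧ x)
              j , kills = common xs
          in i ℕ.+ j , λ where
            y (here x≈y) → begin
              (p ℕ.^ (i ℕ.+ j)) ×ₐ ⟦ α ⟧ y        ≈⟨ ×-congˡ (≡.trans (ℕP.^-distribˡ-+-* p i j) (ℕP.*-comm (p ℕ.^ i) (p ℕ.^ j))) ⟩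
              (p ℕ.^ j ℕ.* p ℕ.^ i) ×ₐ ⟦ α ⟧ y    ≈⟨ kill 0 A (p ℕ.^ i) (p ℕ.^ j) _ (A.trans (×-congʳ (p ℕ.^ i) (A.sym x≈y)) pⁱx≈0) ⟩
              0#                                  ∎
            y (there any) → begin
              (p ℕ.^ (i ℕ.+ j)) ×ₐ ⟦ α ⟧ y        ≈⟨ ×-congˡ (ℕP.^-distribˡ-+-* p i j) ⟩
              (p ℕ.^ i ℕ.* p ℕ.^ j) ×ₐ ⟦ α ⟧ y    ≈⟨ kill 0 A (p ℕ.^ j) (p ℕ.^ i) _ (kills y any) ⟩
              0#                                  ∎

    reduce-cong : ∀ n {a b : Cocycle (Tₕ (suc n))} → _~_ (Tₕ (suc n)) a b →
                  _~_ (Tₕ 1) (reduce n a) (reduce n b)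
    reduce-cong n {a} {b} (x , e) = red.⟦_⟧ n x , λ g →
      T.trans 1 (red.⟦⟧-cong n (e g)) (T.trans 1 (red.homo n _ _)
        (T.+-congˡ 1 (hom-∂ {M = Tₕ (suc n)} {Tₕ 1} (restrictHom H {T (suc n)} {T 1} (red n)) x g)))

    -- Lifting classes by means of a Hilbert 90 module

    module _ {m} (M : DiscreteModule G m) (p-divisible : Divisible M p)
             (iso : ModuleIso (primaryTorsion p M) A)
             (H¹-trivial : IsTrivial (H¹ (restrict H M))) where
      private
        module M = DiscreteModule M
        module iso = ModuleIso iso
        open IsGroupIsomorphism iso.isGroupIsomorphism using (isGroupHomomorphism; injective; surjective)
          renaming (⟦⟧-cong to φ-cong)
        module M× = Mult M.commutativeMonoid
        P = primaryTorsion p M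
        module P = DiscreteModule P
        module P× = Mult P.commutativeMonoid
        Mₕ = restrict H M
        Pₕ = restrict H P
        φ : ModuleHom P A
        φ = record { ⟦_⟧ = iso.⟦_⟧ ; isGroupHomomorphism = isGroupHomomorphism ; equivariant = iso.equivariant }
        φₕ = restrictHom H {P} {A} φ
        ι = torsionInclusion p M
        ιₕ = restrictHom H {P} {M} ι

        preimage : A.Carrier → P.Carrier
        preimage s = proj₁ (surjective s)
        φ-preimage : ∀ s → iso.⟦_⟧ (preimage s) A.≈ s
        φ-preimage s = proj₂ (surjective s) {preimage s} M.refl

      lift-class : ∀ n → Lifts n
      lift-class n c = a , λ {b} b~a →
        ~-trans (Tₕ 1) {reduce n b} {reduce n a} {c} (reduce-cong n {b} {a} b~a)
          (pointwise (Tₕ 1) {reduce n a} {c} a↦c)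
        where
        Jc : Cocycle Aₕ
        Jc = H¹-map {M = Tₕ 1} {Aₕ} (Jₕ 1) c

        c̃ : Cocycle Pₕ
        c̃ = lift-cocycle {M = Pₕ} {Aₕ} φₕ (λ {x} {y} → injective {x} {y}) Jc
              (λ g → preimage (⟦ Jc ⟧ g)) (λ g → φ-preimage (⟦ Jc ⟧ g))

        pφc̃≈0 : ∀ g → iso.⟦_⟧ (p P×.× ⟦ c̃ ⟧ g) A.≈ iso.⟦_⟧ P.0#
        pφc̃≈0 g = begin
          iso.⟦_⟧ (p P×.× ⟦ c̃ ⟧ g)        ≈⟨ hom-× {M = P} {A} φ p (⟦ c̃ ⟧ g) ⟩
          p ×ₐ iso.⟦_⟧ (⟦ c̃ ⟧ g)          ≈⟨ ×-congʳ p (φ-preimage (⟦ Jc ⟧ g)) ⟩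
          p ×ₐ J.⟦_⟧ 1 (⟦ c ⟧ g)          ≈⟨ J-killed (⟦ c ⟧ g) ⟩
          A.0#                            ≈⟨ ModuleHom.ε-homo φ ⟨
          iso.⟦_⟧ P.0#                    ∎
          where open SetoidReasoning A.setoid

        bounding : ∃[ x ] ∀ g → proj₁ (⟦ c̃ ⟧ g) M.≈ M.0# M.+ ∂ Mₕ x g
        bounding = H¹-trivial (H¹-map {M = Pₕ} {Mₕ} ιₕ c̃)
        x = proj₁ bounding
        root : ∃[ y ] (p ℕ.^ n) M×.× y M.≈ x
        root = ^-divisible M p p-divisible n x
        y = proj₁ root

        d : Cocycle Mₕ
        d = coboundary Mₕ y

        pⁿd≈c̃ : ∀ g → (p ℕ.^ n) M×.× ⟦ d ⟧ g M.≈ proj₁ (⟦ c̃ ⟧ g)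
        pⁿd≈c̃ g = begin
          (p ℕ.^ n) M×.× ⟦ d ⟧ g          ≈⟨ hom-∂ {M = Mₕ} {Mₕ} (scale Mₕ (p ℕ.^ n)) y g ⟩
          ∂ Mₕ ((p ℕ.^ n) M×.× y) g       ≈⟨ ∂-cong Mₕ (proj₂ root) g ⟩
          ∂ Mₕ x g                        ≈⟨ M.+-identityˡ _ ⟨
          M.0# M.+ ∂ Mₕ x g               ≈⟨ proj₂ bounding g ⟨
          proj₁ (⟦ c̃ ⟧ g)                 ∎
          where open SetoidReasoning M.setoid

        -- Since `iso` sends the values of `c̃` into A[p], these are killed by p; and they equal pⁿ
        -- d. So the values of d are torsion of the order that `J (suc n)` reaches.
        d-torsion : ∀ g → (p ℕ.^ suc n) M×.× ⟦ d ⟧ g M.≈ M.0#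
        d-torsion g = begin
          (p ℕ.^ suc n) M×.× ⟦ d ⟧ g            ≈⟨ M×.×-assocˡ _ p (p ℕ.^ n) ⟨
          p M×.× ((p ℕ.^ n) M×.× ⟦ d ⟧ g)       ≈⟨ M×.×-congʳ p (pⁿd≈c̃ g) ⟩
          p M×.× proj₁ (⟦ c̃ ⟧ g)                ≈⟨ hom-× {M = P} {M} ι p (⟦ c̃ ⟧ g) ⟨
          proj₁ (p P×.× ⟦ c̃ ⟧ g)                ≈⟨ injective {p P×.× ⟦ c̃ ⟧ g} {P.0#} (pφc̃≈0 g) ⟩
          M.0#                                  ∎
          where open SetoidReasoning M.setoid

        d̃ : Cocycle Pₕ
        d̃ = lift-cocycle {M = Pₕ} {Mₕ} ιₕ id d (λ g → ⟦ d ⟧ g , suc n , d-torsion g) (λ _ → M.refl)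

        φd̃ : Cocycle Aₕ
        φd̃ = H¹-map {M = Pₕ} {Aₕ} φₕ d̃

        -- Transports relations from M to A through the torsion submodule. With z = 0 it shows that
        -- `φd̃` comes from `T (suc n)`; with z a value of `c̃` it identifies the reduction.
        ×-φd̃ : ∀ k g (z : P.Carrier) → k M×.× ⟦ d ⟧ g M.≈ proj₁ z → k ×ₐ ⟦ φd̃ ⟧ g A.≈ iso.⟦_⟧ z
        ×-φd̃ k g z e = begin
          k ×ₐ ⟦ φd̃ ⟧ g                ≈⟨ hom-× {M = P} {A} φ k (⟦ d̃ ⟧ g) ⟨
          iso.⟦_⟧ (k P×.× ⟦ d̃ ⟧ g)     ≈⟨ φ-cong {k P×.× ⟦ d̃ ⟧ g} {z}
                                            (M.trans (hom-× {M = P} {M} ι k (⟦ d̃ ⟧ g)) e) ⟩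
          iso.⟦_⟧ z                    ∎
          where open SetoidReasoning A.setoid

        onto : ∀ g → ∃[ x ] J.⟦_⟧ (suc n) x A.≈ ⟦ φd̃ ⟧ g
        onto g = J-onto (suc n) _
          (A.trans (×-φd̃ (p ℕ.^ suc n) g P.0# (d-torsion g)) (ModuleHom.ε-homo φ))

        a : Cocycle (Tₕ (suc n))
        a = lift-cocycle {M = Tₕ (suc n)} {Aₕ} (Jₕ (suc n)) (J-injective (suc n)) φd̃
              (proj₁ ∘ onto) (proj₂ ∘ onto)

        a↦c : ∀ g → T._≈_ 1 (red.⟦_⟧ n (⟦ a ⟧ g)) (⟦ c ⟧ g)
        a↦c g = J-injective 1 (begin
          J.⟦_⟧ 1 (red.⟦_⟧ n (⟦ a ⟧ g))              ≈⟨ J-red n (⟦ a ⟧ g) ⟨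
          (p ℕ.^ n) ×ₐ J.⟦_⟧ (suc n) (⟦ a ⟧ g)       ≈⟨ ×-congʳ (p ℕ.^ n) (proj₂ (onto g)) ⟩
          (p ℕ.^ n) ×ₐ ⟦ φd̃ ⟧ g                      ≈⟨ ×-φd̃ (p ℕ.^ n) g (⟦ c̃ ⟧ g) (pⁿd≈c̃ g) ⟩
          iso.⟦_⟧ (⟦ c̃ ⟧ g)                          ≈⟨ φ-preimage _ ⟩
          J.⟦_⟧ 1 (⟦ c ⟧ g)                          ∎)
          where open SetoidReasoning A.setoid

-- Arithmetic of ℚ/ℤ₍ₚ₎

fromℤ-injective : ∀ {a b} → fromℤ a ≡ fromℤ b → a ≡ b
fromℤ-injective {a} {b} e = cancel (begin
  mkℚᵘ a 0          ≈⟨ toℚᵘ-fromℤ a ⟨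
  toℚᵘ (fromℤ a)    ≡⟨ cong toℚᵘ e ⟩
  toℚᵘ (fromℤ b)    ≈⟨ toℚᵘ-fromℤ b ⟩
  mkℚᵘ b 0          ∎)
  where
  open SetoidReasoning ℚᵘP.≃-setoid
  cancel : mkℚᵘ a 0 ℚᵘ.≃ mkℚᵘ b 0 → a ≡ b
  cancel (*≡* e) = ≡.trans (≡.sym (ℤP.*-identityʳ a)) (≡.trans e (ℤP.*-identityʳ b))

fromℤ-+ : ∀ a b → fromℤ (a ℤ.+ b) ≡ fromℤ a ℚ.+ fromℤ b
fromℤ-+ a b = begin
  fromℤ (a ℤ.+ b)                              ≡⟨ solve 2 (λ x y → x := x :- y :+ y) refl (fromℤ (a ℤ.+ b)) (fromℤ b) ⟩
  fromℤ (a ℤ.+ b) ℚ.- fromℤ b ℚ.+ fromℤ b      ≡⟨ cong (ℚ._+ fromℤ b) (fromℤ-- (a ℤ.+ b) b) ⟨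
  fromℤ (a ℤ.+ b ℤ.- b) ℚ.+ fromℤ b            ≡⟨ cong (λ x → fromℤ x ℚ.+ fromℤ b) (Z.solve 2 (λ a b → a Z.:+ b Z.:- b Z.:= a) refl a b) ⟩
  fromℤ a ℚ.+ fromℤ b                          ∎
  where
  open ≡-Reasoning
  open ℚ-Solver
  module Z = ℤ-Solver

fromℤ-neg : ∀ a → fromℤ (ℤ.- a) ≡ ℚ.- fromℤ a
fromℤ-neg a = begin
  fromℤ (ℤ.- a)            ≡⟨ cong fromℤ (ℤP.+-identityˡ (ℤ.- a)) ⟨
  fromℤ (0ℤ ℤ.- a)         ≡⟨ fromℤ-- 0ℤ a ⟩
  0ℚ ℚ.- fromℤ a           ≡⟨ ℚP.+-identityˡ (ℚ.- fromℤ a) ⟩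
  ℚ.- fromℤ a              ∎
  where open ≡-Reasoning

denominator-* : ∀ x → fromℤ (↧ x) ℚ.* x ≡ fromℤ (↥ x)
denominator-* x@record{} = ℚP.toℚᵘ-injective (begin
  toℚᵘ (fromℤ (↧ x) ℚ.* x)             ≈⟨ ℚP.toℚᵘ-homo-* (fromℤ (↧ x)) x ⟩
  toℚᵘ (fromℤ (↧ x)) ℚᵘ.* toℚᵘ x       ≈⟨ ℚᵘP.*-congʳ (toℚᵘ-fromℤ (↧ x)) ⟩
  mkℚᵘ (↧ x) 0 ℚᵘ.* toℚᵘ x             ≈⟨ *≡* (≡.trans (ℤP.*-identityʳ (↧ x ℤ.* ↥ x))
                                            (≡.trans (ℤP.*-comm (↧ x) (↥ x))
                                              (cong (λ d → ↥ x ℤ.* + d) (≡.sym (ℕP.*-identityˡ (↧ₙ x)))))) ⟩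
  mkℚᵘ (↥ x) 0                         ≈⟨ toℚᵘ-fromℤ (↥ x) ⟨
  toℚᵘ (fromℤ (↥ x))                   ∎)
  where open SetoidReasoning ℚᵘP.≃-setoid

recip : ∀ k .{{_ : ℕ.NonZero k}} → ℚ
recip k = 1ℤ ℚ./ k

*-recip : ∀ k .{{_ : ℕ.NonZero k}} → fromℤ (+ k) ℚ.* recip k ≡ 1ℚ
*-recip k@(suc k-1) = ℚP.toℚᵘ-injective (begin
  toℚᵘ (fromℤ (+ k) ℚ.* recip k)             ≈⟨ ℚP.toℚᵘ-homo-* (fromℤ (+ k)) (recip k) ⟩
  toℚᵘ (fromℤ (+ k)) ℚᵘ.* toℚᵘ (recip k)     ≈⟨ ℚᵘP.*-cong (toℚᵘ-fromℤ (+ k)) (ℚP.toℚᵘ-fromℚᵘ (mkℚᵘ 1ℤ k-1)) ⟩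
  mkℚᵘ (+ k) 0 ℚᵘ.* mkℚᵘ 1ℤ k-1              ≈⟨ *≡* (≡.trans (ℤP.*-identityʳ _) (≡.trans (ℤP.*-identityʳ (+ k))
                                                  (≡.sym (≡.trans (ℤP.*-identityˡ _) (cong +_ (ℕP.*-identityˡ k)))))) ⟩
  toℚᵘ 1ℚ                                    ∎)
  where open SetoidReasoning ℚᵘP.≃-setoid

module Arithmetic {p : ℕ} (p-prime : Prime p) where
  private instance
    p≢0 : ℕ.NonZero p
    p≢0 = prime⇒nonZero p-prime

  Integral : ℚ → Set
  Integral = _∈ℤ₍ₚ₎ p-prime

  -- A common divisor of pⁿ⁺¹ and d is coprime to p, because p does not divide d; hence a factor p
  -- can be cancelled and it divides pⁿ.
  coprime-p^ : ∀ {d} → p ∤ d → ∀ n → Coprime (p ℕ.^ n) d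
  coprime-p^ p∤d zero    (i∣1 , _) = ℕ∣.∣1⇒≡1 i∣1
  coprime-p^ {d} p∤d (suc n) {i} (i∣pⁿ⁺¹ , i∣d) = coprime-p^ p∤d n
    (coprime-divisor {i} {p} i⊥p i∣pⁿ⁺¹ , i∣d)
    where
    i⊥p : Coprime i p
    i⊥p {j} (j∣i , j∣p) with prime⇒irreducible p-prime j∣p
    ... | inj₁ j≡1 = j≡1
    ... | inj₂ refl = contradiction (ℕ∣.∣-trans j∣i i∣d) p∤d

  inverse-mod : ∀ {d} → p ∤ d → ∀ n → ∃[ e ] ∃[ k ] + d ℤ.* e ≡ 1ℤ ℤ.+ k ℤ.* + (p ℕ.^ n)
  inverse-mod {d} p∤d n with coprime-Bézout (coprime-p^ p∤d n)
  ... | Bézout.+- x y eq = ℤ.- + y , ℤ.- + x , (begin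
    + d ℤ.* ℤ.- + y                             ≡⟨ solve 2 (λ d y → d :* :- y := con 1ℤ :+ :- (con 1ℤ :+ y :* d)) refl (+ d) (+ y) ⟩
    1ℤ ℤ.+ ℤ.- (1ℤ ℤ.+ + y ℤ.* + d)             ≡⟨ cong (λ z → 1ℤ ℤ.+ ℤ.- (1ℤ ℤ.+ z)) (ℤP.pos-* y d) ⟨
    1ℤ ℤ.+ ℤ.- (+ (1 ℕ.+ y ℕ.* d))              ≡⟨ cong (λ z → 1ℤ ℤ.+ ℤ.- (+ z)) eq ⟩
    1ℤ ℤ.+ ℤ.- (+ (x ℕ.* p ℕ.^ n))              ≡⟨ cong (λ z → 1ℤ ℤ.+ ℤ.- z) (ℤP.pos-* x (p ℕ.^ n)) ⟩
    1ℤ ℤ.+ ℤ.- (+ x ℤ.* + (p ℕ.^ n))            ≡⟨ cong (λ z → 1ℤ ℤ.+ z) (ℤP.neg-distribˡ-* (+ x) (+ (p ℕ.^ n))) ⟩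
    1ℤ ℤ.+ ℤ.- + x ℤ.* + (p ℕ.^ n)              ∎)
    where
    open ≡-Reasoning
    open ℤ-Solver
  ... | Bézout.-+ x y eq = + y , + x , (begin
    + d ℤ.* + y                                 ≡⟨ ℤP.*-comm (+ d) (+ y) ⟩
    + y ℤ.* + d                                 ≡⟨ ℤP.pos-* y d ⟨
    + (y ℕ.* d)                                 ≡⟨ cong +_ eq ⟨
    1ℤ ℤ.+ + (x ℕ.* p ℕ.^ n)                    ≡⟨ cong (λ z → 1ℤ ℤ.+ z) (ℤP.pos-* x (p ℕ.^ n)) ⟩
    1ℤ ℤ.+ + x ℤ.* + (p ℕ.^ n)                  ∎)
    where open ≡-Reasoning

  p^ : ℕ → ℚ
  p^ n = fromℤ (+ (p ℕ.^ n))

  p⁻ : ℕ → ℚ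
  p⁻ zero    = 1ℚ
  p⁻ (suc n) = recip p ℚ.* p⁻ n

  p-p⁻ : ∀ n → fromℤ (+ p) ℚ.* p⁻ (suc n) ≡ p⁻ n
  p-p⁻ n = begin
    fromℤ (+ p) ℚ.* (recip p ℚ.* p⁻ n)   ≡⟨ ℚP.*-assoc (fromℤ (+ p)) (recip p) (p⁻ n) ⟨
    fromℤ (+ p) ℚ.* recip p ℚ.* p⁻ n     ≡⟨ cong (ℚ._* p⁻ n) (*-recip p) ⟩
    1ℚ ℚ.* p⁻ n                          ≡⟨ ℚP.*-identityˡ (p⁻ n) ⟩
    p⁻ n                                 ∎
    where open ≡-Reasoning

  p^-suc : ∀ n → p^ (suc n) ≡ fromℤ (+ p) ℚ.* p^ n
  p^-suc n = ≡.trans (cong fromℤ (ℤP.pos-* p (p ℕ.^ n))) (fromℤ-* (+ p) (+ (p ℕ.^ n)))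

  p^-p⁻ : ∀ n k → p^ n ℚ.* p⁻ (n ℕ.+ k) ≡ p⁻ k
  p^-p⁻ zero    k = ℚP.*-identityˡ (p⁻ k)
  p^-p⁻ (suc n) k = begin
    p^ (suc n) ℚ.* p⁻ (suc n ℕ.+ k)                     ≡⟨ cong (ℚ._* p⁻ (suc n ℕ.+ k)) (p^-suc n) ⟩
    fromℤ (+ p) ℚ.* p^ n ℚ.* p⁻ (suc n ℕ.+ k)           ≡⟨ solve 3 (λ a b c → a :* b :* c := b :* (a :* c)) refl (fromℤ (+ p)) (p^ n) (p⁻ (suc n ℕ.+ k)) ⟩
    p^ n ℚ.* (fromℤ (+ p) ℚ.* p⁻ (suc n ℕ.+ k))         ≡⟨ cong (p^ n ℚ.*_) (p-p⁻ (n ℕ.+ k)) ⟩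
    p^ n ℚ.* p⁻ (n ℕ.+ k)                               ≡⟨ p^-p⁻ n k ⟩
    p⁻ k                                                ∎
    where
    open ≡-Reasoning
    open ℚ-Solver

  p^-p⁻≡1 : ∀ n → p^ n ℚ.* p⁻ n ≡ 1ℚ
  p^-p⁻≡1 n = ≡.trans (cong (λ k → p^ n ℚ.* p⁻ k) (≡.sym (ℕP.+-identityʳ n))) (p^-p⁻ n 0)

  -- Clearing the denominator d of z gives d w = pⁿ u, where u is its numerator. With d e = 1 + k pⁿ
  -- this becomes w = d e w - k pⁿ w = (u e - k w) pⁿ, whence the witness.
  integral⇒∣ : ∀ n w z → Integral z → p^ n ℚ.* z ≡ fromℤ w → w ≡ 0ℤ [mod p ℕ.^ n ]
  integral⇒∣ n w z z∈ pⁿz≡w with inverse-mod z∈ n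
  ... | e , k , de≡ = divides (↥ z ℤ.* e ℤ.- k ℤ.* w) (begin
    w ℤ.- 0ℤ                                         ≡⟨ solve 3 (λ w k q → w :- con 0ℤ := (con 1ℤ :+ k :* q) :* w :- k :* q :* w) refl w k q ⟩
    (1ℤ ℤ.+ k ℤ.* q) ℤ.* w ℤ.- k ℤ.* q ℤ.* w         ≡⟨ cong (λ x → x ℤ.* w ℤ.- k ℤ.* q ℤ.* w) de≡ ⟨
    ↧ z ℤ.* e ℤ.* w ℤ.- k ℤ.* q ℤ.* w                ≡⟨ solve 5 (λ d e w k q → d :* e :* w :- k :* q :* w := (d :* w) :* e :- k :* q :* w) refl (↧ z) e w k q ⟩
    (↧ z ℤ.* w) ℤ.* e ℤ.- k ℤ.* q ℤ.* w              ≡⟨ cong (λ x → x ℤ.* e ℤ.- k ℤ.* q ℤ.* w) dw≡ ⟩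
    (q ℤ.* ↥ z) ℤ.* e ℤ.- k ℤ.* q ℤ.* w              ≡⟨ solve 5 (λ q n e k w → (q :* n) :* e :- k :* q :* w := (n :* e :- k :* w) :* q) refl q (↥ z) e k w ⟩
    (↥ z ℤ.* e ℤ.- k ℤ.* w) ℤ.* q                    ∎)
    where
    open ≡-Reasoning
    open ℤ-Solver
    q = + (p ℕ.^ n)
    module Q = ℚ-Solver
    dw≡ : ↧ z ℤ.* w ≡ q ℤ.* ↥ z
    dw≡ = fromℤ-injective (begin
      fromℤ (↧ z ℤ.* w)                 ≡⟨ fromℤ-* (↧ z) w ⟩
      fromℤ (↧ z) ℚ.* fromℤ w           ≡⟨ cong (fromℤ (↧ z) ℚ.*_) pⁿz≡w ⟨
      fromℤ (↧ z) ℚ.* (p^ n ℚ.* z)      ≡⟨ Q.solve 3 (λ a b c → a Q.:* (b Q.:* c) Q.:= b Q.:* (a Q.:* c)) refl (fromℤ (↧ z)) (p^ n) z ⟩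
      p^ n ℚ.* (fromℤ (↧ z) ℚ.* z)      ≡⟨ cong (p^ n ℚ.*_) (denominator-* z) ⟩
      p^ n ℚ.* fromℤ (↥ z)              ≡⟨ fromℤ-* q (↥ z) ⟨
      fromℤ (q ℤ.* ↥ z)                 ∎)

  -- Let t = pⁿ s have numerator u and denominator d, and let d e = 1 + k pⁿ. Then x = u e equals (1
  -- + k pⁿ) t, so x p⁻ⁿ - s = k t, which is integral.
  numerator : ∀ n s → Integral (p^ n ℚ.* s) → ∃[ x ] Integral (fromℤ x ℚ.* p⁻ n ℚ.- s)
  numerator n s t∈ with inverse-mod t∈ n
  ... | e , k , de≡ = ↥ t ℤ.* e , subst Integral eq (∈-* p-prime {fromℤ k} {t} (∈-fromℤ p-prime k) t∈)
    where
    open ≡-Reasoning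
    open ℚ-Solver
    t = p^ n ℚ.* s
    eq : fromℤ k ℚ.* t ≡ fromℤ (↥ t ℤ.* e) ℚ.* p⁻ n ℚ.- s
    eq = ≡.sym (begin
      fromℤ (↥ t ℤ.* e) ℚ.* p⁻ n ℚ.- s
        ≡⟨ cong (λ x → x ℚ.* p⁻ n ℚ.- s) (fromℤ-* (↥ t) e) ⟩
      fromℤ (↥ t) ℚ.* fromℤ e ℚ.* p⁻ n ℚ.- s
        ≡⟨ cong (λ x → x ℚ.* fromℤ e ℚ.* p⁻ n ℚ.- s) (denominator-* t) ⟨
      fromℤ (↧ t) ℚ.* t ℚ.* fromℤ e ℚ.* p⁻ n ℚ.- s
        ≡⟨ solve 5 (λ d t e r s → d :* t :* e :* r :- s := (d :* e) :* t :* r :- s) refl (fromℤ (↧ t)) t (fromℤ e) (p⁻ n) s ⟩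
      fromℤ (↧ t) ℚ.* fromℤ e ℚ.* t ℚ.* p⁻ n ℚ.- s
        ≡⟨ cong (λ x → x ℚ.* t ℚ.* p⁻ n ℚ.- s) de≡′ ⟩
      (1ℚ ℚ.+ fromℤ k ℚ.* p^ n) ℚ.* t ℚ.* p⁻ n ℚ.- s
        ≡⟨ solve 4 (λ k q s r → (con 1ℚ :+ k :* q) :* (q :* s) :* r :- s := (con 1ℚ :+ k :* q) :* s :* (q :* r) :- s) refl (fromℤ k) (p^ n) s (p⁻ n) ⟩
      (1ℚ ℚ.+ fromℤ k ℚ.* p^ n) ℚ.* s ℚ.* (p^ n ℚ.* p⁻ n) ℚ.- s
        ≡⟨ cong (λ x → (1ℚ ℚ.+ fromℤ k ℚ.* p^ n) ℚ.* s ℚ.* x ℚ.- s) (p^-p⁻≡1 n) ⟩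
      (1ℚ ℚ.+ fromℤ k ℚ.* p^ n) ℚ.* s ℚ.* 1ℚ ℚ.- s
        ≡⟨ solve 3 (λ k q s → (con 1ℚ :+ k :* q) :* s :* con 1ℚ :- s := k :* (q :* s)) refl (fromℤ k) (p^ n) s ⟩
      fromℤ k ℚ.* t ∎)
      where
      de≡′ : fromℤ (↧ t) ℚ.* fromℤ e ≡ 1ℚ ℚ.+ fromℤ k ℚ.* p^ n
      de≡′ = begin
        fromℤ (↧ t) ℚ.* fromℤ e                        ≡⟨ fromℤ-* (↧ t) e ⟨
        fromℤ (↧ t ℤ.* e)                              ≡⟨ cong fromℤ de≡ ⟩
        fromℤ (1ℤ ℤ.+ k ℤ.* + (p ℕ.^ n))               ≡⟨ fromℤ-+ 1ℤ (k ℤ.* + (p ℕ.^ n)) ⟩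
        1ℚ ℚ.+ fromℤ (k ℤ.* + (p ℕ.^ n))               ≡⟨ cong (1ℚ ℚ.+_) (fromℤ-* k (+ (p ℕ.^ n))) ⟩
        1ℚ ℚ.+ fromℤ k ℚ.* p^ n                        ∎

  -- The module `S` and its pⁿ-torsion

  module _ {ℓ} (Gθ : POrientedProfiniteGroup p ℓ) where
    open POrientedProfiniteGroup Gθ using (θ; θᵣ; compact)
    private
      A = S p-prime Gθ
      module A = DiscreteModule A
    open A using (_≈_)
    open Mult A.commutativeMonoid using () renaming (_×_ to infixl 7 _×ₛ_)

    ×≡* : ∀ k x → k ×ₛ x ≡ fromℤ (+ k) ℚ.* x
    ×≡* zero    x = ≡.sym (ℚP.*-zeroˡ x)
    ×≡* (suc k) x = begin
      x ℚ.+ k ×ₛ x                        ≡⟨ cong (x ℚ.+_) (×≡* k x) ⟩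
      x ℚ.+ fromℤ (+ k) ℚ.* x             ≡⟨ solve 2 (λ x k → x :+ k :* x := (con 1ℚ :+ k) :* x) refl x (fromℤ (+ k)) ⟩
      (1ℚ ℚ.+ fromℤ (+ k)) ℚ.* x          ≡⟨ cong (ℚ._* x) (fromℤ-+ 1ℤ (+ k)) ⟨
      fromℤ (+ suc k) ℚ.* x               ∎
      where
      open ≡-Reasoning
      open ℚ-Solver

    ×≈0⇒integral : ∀ k x → k ×ₛ x ≈ 0ℚ → Integral (fromℤ (+ k) ℚ.* x)
    ×≈0⇒integral k x = subst Integral (≡.trans (ℚP.+-identityʳ (k ×ₛ x)) (×≡* k x))

    integral⇒×≈0 : ∀ k x → Integral (fromℤ (+ k) ℚ.* x) → k ×ₛ x ≈ 0ℚ
    integral⇒×≈0 k x = subst Integral (≡.sym (≡.trans (ℚP.+-identityʳ (k ×ₛ x)) (×≡* k x)))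

    S-divisible : ∀ k .{{_ : ℕ.NonZero k}} → Divisible A k
    S-divisible k x = recip k ℚ.* x , ≡⇒≈ₛ p-prime (begin
      k ×ₛ (recip k ℚ.* x)                  ≡⟨ ×≡* k (recip k ℚ.* x) ⟩
      fromℤ (+ k) ℚ.* (recip k ℚ.* x)       ≡⟨ ℚP.*-assoc (fromℤ (+ k)) (recip k) x ⟨
      fromℤ (+ k) ℚ.* recip k ℚ.* x         ≡⟨ cong (ℚ._* x) (*-recip k) ⟩
      1ℚ ℚ.* x                              ≡⟨ ℚP.*-identityˡ x ⟩
      x                                     ∎)
      where open ≡-Reasoning

    S-p′-divisible : ∀ b → p ∤ b → Divisible A b
    S-p′-divisible zero      p∤0 = contradiction (p ℕ∣.∣0) p∤0
    S-p′-divisible b@(suc _) _   = S-divisible b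

    -- For b prime to p the rational 1/b is itself integral, so integrality of b x passes to x.
    S-torsionFree : ∀ b → p ∤ b → TorsionFree A b
    S-torsionFree zero      p∤0 x _    = contradiction (p ℕ∣.∣0) p∤0
    S-torsionFree b@(suc _) p∤b x bx≈0 = subst Integral (begin
      recip b ℚ.* (fromℤ (+ b) ℚ.* x)       ≡⟨ solve 3 (λ r b x → r :* (b :* x) := (b :* r) :* x) refl (recip b) (fromℤ (+ b)) x ⟩
      (fromℤ (+ b) ℚ.* recip b) ℚ.* x       ≡⟨ cong (ℚ._* x) (*-recip b) ⟩
      1ℚ ℚ.* x                              ≡⟨ ℚP.*-identityˡ x ⟩
      x                                     ≡⟨ ℚP.+-identityʳ x ⟨
      x ℚ.- 0ℚ                              ∎)
      (∈-* p-prime {recip b} {fromℤ (+ b) ℚ.* x} (λ p∣ → p∤b (ℕ∣.∣-trans p∣ (↧/∣ 1ℤ b))) (×≈0⇒integral b x bx≈0))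
      where
      open ≡-Reasoning
      open ℚ-Solver

    S-p-primary : ∀ x → IsPrimaryTorsion p A x
    S-p-primary x = let v , _ , pᵛx-integral = killed p-prime x in v , integral⇒×≈0 (p ℕ.^ v) x pᵛx-integral

    j : ℕ → ℤ → ℚ
    j n x = fromℤ x ℚ.* p⁻ n

    j-- : ∀ n x y → j n (x ℤ.- y) ≡ j n x ℚ.- j n y
    j-- n x y = ≡.trans (cong (ℚ._* p⁻ n) (fromℤ-- x y))
      (solve 3 (λ x y r → (x :- y) :* r := x :* r :- y :* r) refl (fromℤ x) (fromℤ y) (p⁻ n))
      where open ℚ-Solver

    j-cong : ∀ n {x y} → x ≡ y [mod p ℕ.^ n ] → j n x ≈ j n y
    j-cong n {x} {y} (divides c x-y≡) = subst Integral (begin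
      fromℤ c                                   ≡⟨ ℚP.*-identityʳ (fromℤ c) ⟨
      fromℤ c ℚ.* 1ℚ                            ≡⟨ cong (fromℤ c ℚ.*_) (p^-p⁻≡1 n) ⟨
      fromℤ c ℚ.* (p^ n ℚ.* p⁻ n)               ≡⟨ ℚP.*-assoc (fromℤ c) (p^ n) (p⁻ n) ⟨
      fromℤ c ℚ.* p^ n ℚ.* p⁻ n                 ≡⟨ cong (ℚ._* p⁻ n) (fromℤ-* c (+ (p ℕ.^ n))) ⟨
      j n (c ℤ.* + (p ℕ.^ n))                   ≡⟨ cong (j n) x-y≡ ⟨
      j n (x ℤ.- y)                             ≡⟨ j-- n x y ⟩
      j n x ℚ.- j n y                           ∎) (∈-fromℤ p-prime c)
      where open ≡-Reasoning

    j-injective : ∀ n {x y} → j n x ≈ j n y → x ≡ y [mod p ℕ.^ n ]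
    j-injective n {x} {y} jx≈jy = subst (+ (p ℕ.^ n) ∣ℤ_) (ℤP.+-identityʳ (x ℤ.- y))
      (integral⇒∣ n (x ℤ.- y) (j n (x ℤ.- y)) (subst Integral (≡.sym (j-- n x y)) jx≈jy) (begin
        p^ n ℚ.* (fromℤ (x ℤ.- y) ℚ.* p⁻ n)     ≡⟨ solve 3 (λ q x r → q :* (x :* r) := x :* (q :* r)) refl (p^ n) (fromℤ (x ℤ.- y)) (p⁻ n) ⟩
        fromℤ (x ℤ.- y) ℚ.* (p^ n ℚ.* p⁻ n)     ≡⟨ cong (fromℤ (x ℤ.- y) ℚ.*_) (p^-p⁻≡1 n) ⟩
        fromℤ (x ℤ.- y) ℚ.* 1ℚ                  ≡⟨ ℚP.*-identityʳ (fromℤ (x ℤ.- y)) ⟩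
        fromℤ (x ℤ.- y)                         ∎))
      where
      open ≡-Reasoning
      open ℚ-Solver

    J : ∀ n → ModuleHom (TateTwist Gθ n) A
    J n = record
      { ⟦_⟧ = j n
      ; isGroupHomomorphism = record
        { isMonoidHomomorphism = record
          { isMagmaHomomorphism = record
            { isRelHomomorphism = record { cong = λ {x} {y} → j-cong n {x} {y} }
            ; homo              = λ x y → ≡⇒≈ₛ p-prime (≡.trans (cong (ℚ._* p⁻ n) (fromℤ-+ x y))
                                            (ℚP.*-distribʳ-+ (p⁻ n) (fromℤ x) (fromℤ y)))
            }
          ; ε-homo = ≡⇒≈ₛ p-prime (ℚP.*-zeroˡ (p⁻ n))
          }
        ; ⁻¹-homo = λ x → ≡⇒≈ₛ p-prime (≡.trans (cong (ℚ._* p⁻ n) (fromℤ-neg x))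
                            (≡.sym (ℚP.neg-distribˡ-* (fromℤ x) (p⁻ n))))
        }
      -- The twist uses the residue of θ(g) at index n, whereas S uses the one at the denominator of
      -- `j n x`. Both are compared with the residue at `N x`, which dominates the two indices.
      ; equivariant = λ g x → begin
          j n (θᵣ n g ℤ.* x)
            ≈⟨ j-cong n {θᵣ n g ℤ.* x} {θᵣ (N x) g ℤ.* x}
                 (mod-* {a = θᵣ n g} {θᵣ (N x) g} {x} {x}
                   (mod-sym {a = θᵣ (N x) g} {θᵣ n g}
                     (PadicInteger.coherent (proj₁ (θ g)) (ℕP.m≤m+n n (↧ₙ (j n x)))))
                   (mod-refl x)) ⟩
          j n (θᵣ (N x) g ℤ.* x)
            ≡⟨ ≡.trans (cong (ℚ._* p⁻ n) (fromℤ-* (θᵣ (N x) g) x)) (ℚP.*-assoc (fromℤ (θᵣ (N x) g)) (fromℤ x) (p⁻ n)) ⟩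
          fromℤ (θᵣ (N x) g) ℚ.* j n x
            ≈⟨ ⊛-stable p-prime (proj₁ (θ g)) (j n x) (ℕP.m≤n+m (↧ₙ (j n x)) n) ⟩
          _⊛_ p-prime (proj₁ (θ g)) (j n x) ∎
      }
      where
      open SetoidReasoning A.setoid
      N : ℤ → ℕ
      N x = n ℕ.+ ↧ₙ (j n x)

    J-onto : ∀ n s → (p ℕ.^ n) ×ₛ s ≈ 0ℚ → ∃[ x ] j n x ≈ s
    J-onto n s pⁿs≈0 = numerator n s (×≈0⇒integral (p ℕ.^ n) s pⁿs≈0)

    ×-j : ∀ n k x → (p ℕ.^ n) ×ₛ j (n ℕ.+ k) x ≡ j k x
    ×-j n k x = begin
      (p ℕ.^ n) ×ₛ j (n ℕ.+ k) x                 ≡⟨ ×≡* (p ℕ.^ n) (j (n ℕ.+ k) x) ⟩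
      p^ n ℚ.* (fromℤ x ℚ.* p⁻ (n ℕ.+ k))        ≡⟨ solve 3 (λ q x r → q :* (x :* r) := x :* (q :* r)) refl (p^ n) (fromℤ x) (p⁻ (n ℕ.+ k)) ⟩
      fromℤ x ℚ.* (p^ n ℚ.* p⁻ (n ℕ.+ k))        ≡⟨ cong (fromℤ x ℚ.*_) (p^-p⁻ n k) ⟩
      j k x                                      ∎
      where
      open ≡-Reasoning
      open ℚ-Solver

    J-red : ∀ n x → (p ℕ.^ n) ×ₛ j (suc n) x ≈ j 1 x
    J-red n x = ≡⇒≈ₛ p-prime
      (≡.trans (cong (λ k → (p ℕ.^ n) ×ₛ j k x) (≡.sym (ℕP.+-comm n 1))) (×-j n 1 x))

    J-killed : ∀ x → p ×ₛ j 1 x ≈ 0ℚ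
    J-killed x = integral⇒×≈0 p (j 1 x) (subst Integral (begin
      fromℤ x                         ≡⟨ ℚP.*-identityʳ (fromℤ x) ⟨
      j 0 x                           ≡⟨ ×-j 1 0 x ⟨
      (p ℕ.^ 1) ×ₛ j 1 x              ≡⟨ cong (_×ₛ j 1 x) (ℕP.^-identityʳ p) ⟩
      p ×ₛ j 1 x                      ≡⟨ ×≡* p (j 1 x) ⟩
      fromℤ (+ p) ℚ.* j 1 x           ∎) (∈-fromℤ p-prime x))
      where open ≡-Reasoning

    kummerTower : KummerTower p A
    kummerTower = record
      { T           = TateTwist Gθ
      ; J           = J
      ; red         = λ n → reduction Gθ {1} {suc n} (ℕ.s≤s ℕ.z≤n)
      ; J-killed    = J-killed
      ; J-injective = λ n {x} {y} → j-injective n {x} {y}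
      ; J-onto      = J-onto
      ; J-red       = J-red
      }

    module K = Kummer kummerTower

    -- The two implications

    formalHilbert90⇒module : ExcludedMiddle (lsuc ℓ) → FormalHilbert90 Gθ →
                             HasHilbert90Module p-prime Gθ
    formalHilbert90⇒module em H90 = towerModule , record
      { p-divisible = towerModule-p-divisible
      ; torsion-iso = towerModule-torsion (S-divisible p) S-p-primary
      ; H¹-vanishes = V.towerModule-H¹-trivial
      }
      where
      open TowerModule em p A
      H¹-divisible : ∀ H → H¹-Divisible (restrict H A) p
      H¹-divisible H α =
        let n , pⁿα≈0 = K.exponent H em compact S-p-primary α
        in K.torsion-divisible H (λ k → H90 H {suc k} (ℕ.s≤s ℕ.z≤n)) (S-divisible p) n α pⁿα≈0
      module V = Vanishing em p-prime compact A (S-divisible p) S-p′-divisible S-torsionFree H¹-divisible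

    module⇒formalHilbert90 : HasHilbert90Module p-prime Gθ → FormalHilbert90 Gθ
    module⇒formalHilbert90 (M , isHilbert90) H {suc n} (ℕ.s≤s ℕ.z≤n) =
      K.lift-class H M p-divisible torsion-iso (H¹-vanishes H) n
      where open IsHilbert90Module isHilbert90

theorem1p5 : ∀ {ℓ} → ExcludedMiddle (lsuc ℓ) →
    (p : ℕ) (p-prime : Prime p) (Gθ : POrientedProfiniteGroup p ℓ) →
    FormalHilbert90 Gθ ⇔ HasHilbert90Module p-prime Gθ
theorem1p5 em p p-prime Gθ = mk⇔ (formalHilbert90⇒module Gθ em) (module⇒formalHilbert90 Gθ)
  where open Arithmetic p-prime
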